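{- If $n$ is a positive integer and $p$, $q$ and $t$ are any integers, then $$\sum_{k=1}^n(-1)^{q(n-k)}\frac{k}{n+k}\binom{n+k}{n-k}F_p^{n-k}F_{p+q}^{n-k}F_q^{2k-1}L_{(2p+q)k+t}=\frac{F_{p+q}^{2n}\bigl(F_{p+q}L_{p+t+qn}+F_pL_{q+p+t+qn}\bigr)-F_p^{2n}\bigl(F_{p+q}L_{p+t-qn}+F_pL_{q+p+t-qn}\bigr)}{2\bigl(F_{p+q}^2+F_pF_{p+q}L_q+(-1)^qF_p^2\bigr)},$$ $$\sum_{k=1}^n(-1)^{q(n-k)}\frac{k}{n+k}\binom{n+k}{n-k}F_p^{n-k}F_{p+q}^{n-k}F_q^{2k-1}F_{(2p+q)k+t}=\frac{F_{p+q}^{2n}\bigl(F_{p+q}F_{p+t+qn}+F_pF_{q+p+t+qn}\bigr)-F_p^{2n}\bigl(F_{p+q}F_{p+t-qn}+F_pF_{p+q+t-qn}\bigr)}{2\bigl(F_{p+q}^2+F_pF_{p+q}L_q+(-1)^qF_p^2\bigr)},$$ $$\sum_{k=1}^n(-1)^{q(n-k)}\frac{k}{n+k}\binom{n+k}{n-k}L_p^{n-k}L_{p+q}^{n-k}F_q^{2k-1}5^kF_{(2p+q)k+t}=\frac{L_{p+q}^{2n}\bigl(L_{p+q}L_{p+t+qn}+L_pL_{q+p+t+qn}\bigr)-L_p^{2n}\bigl(L_{p+q}L_{p+t-qn}+L_pL_{p+q+t-qn}\bigr)}{2\bigl(L_{p+q}^2+L_pL_{p+q}L_q+(-1)^qL_p^2\bigr)},$$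 $$\sum_{k=1}^n(-1)^{q(n-k)}\frac{k}{n+k}\binom{n+k}{n-k}L_p^{n-k}L_{p+q}^{n-k}F_q^{2k-1}5^{k-1}L_{(2p+q)k+t}=\frac{L_{p+q}^{2n}\bigl(L_{p+q}F_{qn+p+t}+L_pF_{q+p+t+qn}\bigr)-L_p^{2n}\bigl(L_{p+q}F_{p+t-qn}+L_pF_{p+q+t-qn}\bigr)}{2\bigl(L_{p+q}^2+L_pL_{p+q}L_q+(-1)^qL_p^2\bigr)}.$$
   Context: $F_n$ and $L_n$ ($n\in\mathbb{Z}$) are the Fibonacci and Lucas numbers: $F_0=0$, $F_1=1$, $F_n=F_{n-1}+F_{n-2}$; $L_0=2$, $L_1=1$, $L_n=L_{n-1}+L_{n-2}$, extended to negative indices by $F_{ -n}=(-1)^{n-1}F_n$, $L_{ -n}=(-1)^nL_n$.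
   Formalization: In the first two identities the case p = q = 0 is excluded, because there the denominator on the right-hand side is 0 and the quotient reads 0/0; all other integers p, q, t are covered, and that the denominators are nonzero is proved. -}

module Defs where

open import Data.Nat.Base as ℕ using (ℕ; zero; suc)
open import Data.Integer.Base as ℤ using (ℤ; +_; -[1+_]; -1ℤ)
open import Data.Rational.Base as ℚ using (ℚ; 0ℚ; NonZero; _÷_)
open import Data.Product.Base using (Σ-syntax)
open import Relation.Binary.PropositionalEquality.Core using (_≡_)

fib : ℕ → ℕ
fib 0             = 0
fib 1             = 1
fib (suc (suc n)) = fib (suc n) ℕ.+ fib n

luc : ℕ → ℕ
luc 0             = 2
luc 1             = 1
luc (suc (suc n)) = luc (suc n) ℕ.+ luc n

-- (-1)^m for an integer exponent; the sign of m is immaterial as -1 is its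
-- own inverse.
infix 8 [-1]^_
[-1]^_ : ℤ → ℤ
[-1]^ m = -1ℤ ℤ.^ ℤ.∣ m ∣

-- -[1+ m ] is -(m + 1), so F₋₍ₘ₊₁₎ = (-1)^m Fₘ₊₁ and L₋₍ₘ₊₁₎ = (-1)^(m+1) Lₘ₊₁.
F : ℤ → ℤ
F (+ n)    = + fib n
F -[1+ m ] = [-1]^ (+ m) ℤ.* + fib (suc m)

L : ℤ → ℤ
L (+ n)    = + luc n
L -[1+ m ] = [-1]^ (+ suc m) ℤ.* + luc (suc m)

fromℤ : ℤ → ℚ
fromℤ z = z ℚ./ 1

∑[1…_] : ℕ → (ℕ → ℚ) → ℚ
∑[1… zero  ] f = 0ℚ
∑[1… suc n ] f = ∑[1… n ] f ℚ.+ f (suc n)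

+-nonZero : ∀ m n .{{_ : ℕ.NonZero m}} → ℕ.NonZero (m ℕ.+ n)
+-nonZero (suc m) n = _

-- x = a / b, where b ≠ 0 is part of the assertion.
infix 4 _equals_over_
_equals_over_ : ℚ → ℤ → ℤ → Set
x equals a over b =
  Σ[ b≢0 ∈ NonZero (fromℤ b) ] x ≡ _÷_ (fromℤ a) (fromℤ b) {{b≢0}}

{-# OPTIONS --safe #-}
module Submission where

-- Write x = U (p + q), y = U p, s = (-1)^q and w = s x y, where U is F or L.
-- Since k/(n+k) · C(n+k, n-k) = C(n+k-1, 2k-1)/2, twice the left-hand side is a
-- sum of terms C(n+k-1, 2k-1) w^(n-k) z^(k-1) a, where z multiplies a sequence by
-- a constant E (F q ² or 5 F q ²) and shifts its index by 2p + q.  By Pascal's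
-- rule such sums satisfy S (n+2) = (2w + z) S (n+1) - w² S n.  The addition
-- formula x G (m+q) - s y G m = F q Ĝ (m+p+q), with Ĝ = G for U = F and with Ĝ
-- the companion sequence (F ↦ L, L ↦ 5F) for U = L, used twice, shows that
-- x² G (m+q) + y² G (m-q) = 2w G m + E G (m+2p+q), so the numerators on the
-- right-hand side obey the same recurrence.  Half the denominator, D, satisfies
-- 4D = (2x + y L q)² - 5 (F q y)², and it vanishes only if x = y = 0, as √5 is
-- irrational.

open import Defs
open import Data.Nat.Base as ℕ using (ℕ; zero; suc; _∸_)
import Data.Nat.Properties as ℕ
open import Data.Nat.Combinatorics using (_C_; nCk+nC[k+1]≡[n+1]C[k+1]; k>n⇒nCk≡0; nCk≡nC[n∸k]; nC1≡n)
open import Data.Nat.Divisibility using (divides)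
open import Data.Nat.Induction using (<-rec)
open import Data.Nat.Primality using (Prime; prime?; euclidsLemma)
import Data.Nat.Tactic.RingSolver as ℕ-Solver
open import Data.Integer.Base using (ℤ; +_; -[1+_]; 0ℤ; 1ℤ; -1ℤ; _+_; _-_; _*_; _^_; -_; ∣_∣)
open import Data.Integer.GCD using (gcd)
import Data.Integer.Properties as ℤ
open import Data.Integer.Tactic.RingSolver using (solve-∀)
open import Algebra.Properties.AbelianGroup ℤ.+-0-abelianGroup using () renaming (∙-cancelˡ to +-cancelˡ; ∙-cancelʳ to +-cancelʳ)
open import Data.Product.Base using (_×_; _,_; proj₁)
open import Data.Rational.Base as ℚ using (ℚ; 0ℚ; 1ℚ; _/_; toℚᵘ)
import Data.Rational.Properties as ℚ
open import Data.Rational.Unnormalised.Base as ℚᵘ using (mkℚᵘ; *≡*; _≃_)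
import Data.Rational.Unnormalised.Properties as ℚᵘ
open import Data.Sum.Base using (_⊎_; inj₁; inj₂; [_,_]′; reduce)
open import Function.Base using (_∘_; id)
open import Relation.Nullary.Decidable using (yes; no; from-yes)
open import Relation.Nullary.Negation.Core using (¬_; contradiction)
open import Relation.Binary.PropositionalEquality

-- Signs and Fibonacci-like sequences

-- With `1ℤ` on the left both steps compute: `1ℤ + + n` reduces to `+ suc n` and `1ℤ + -[1+ suc n ]`
-- to `-[1+ n ]`, so nothing has to be transported.
ℤ-induction : (P : ℤ → Set) → P 0ℤ → (∀ m → P m → P (1ℤ + m)) →
              (∀ m → P (1ℤ + m) → P m) → ∀ m → P m
ℤ-induction P P0 up down (+ zero)       = P0
ℤ-induction P P0 up down (+ suc n)      = up (+ n) (ℤ-induction P P0 up down (+ n))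
ℤ-induction P P0 up down -[1+ zero ]    = down -[1+ 0 ] P0
ℤ-induction P P0 up down -[1+ suc n ]   =
  down -[1+ suc n ] (ℤ-induction P P0 up down -[1+ n ])

[-1]^-suc : ∀ m → [-1]^ (1ℤ + m) ≡ - [-1]^ m
[-1]^-suc (+ n)          = ℤ.-1*i≡-i _
[-1]^-suc -[1+ zero ]    = refl
[-1]^-suc -[1+ suc n ]   = lemma ([-1]^ (+ suc n))
  where
  lemma : ∀ e → e ≡ - (-1ℤ * e)
  lemma = solve-∀

[-1]^-square : ∀ m → [-1]^ m * [-1]^ m ≡ 1ℤ
[-1]^-square = ℤ-induction _ refl
  (λ m h → trans (lemma m) h) (λ m h → trans (sym (lemma m)) h)
  where
  neg-square : ∀ e → - e * - e ≡ e * e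
  neg-square = solve-∀
  lemma : ∀ m → [-1]^ (1ℤ + m) * [-1]^ (1ℤ + m) ≡ [-1]^ m * [-1]^ m
  lemma m rewrite [-1]^-suc m = neg-square ([-1]^ m)

[-1]^-+ : ∀ m n → [-1]^ (m + n) ≡ [-1]^ m * [-1]^ n
[-1]^-+ m n = ℤ-induction (λ m → [-1]^ (m + n) ≡ [-1]^ m * [-1]^ n)
  (trans (cong [-1]^_ (ℤ.+-identityˡ n)) (sym (ℤ.*-identityˡ _)))
  (λ m h → begin
     [-1]^ (1ℤ + m + n)         ≡⟨ shift m ⟩
     - [-1]^ (m + n)            ≡⟨ cong -_ h ⟩
     - ([-1]^ m * [-1]^ n)      ≡⟨ ℤ.neg-distribˡ-* ([-1]^ m) _ ⟩
     - [-1]^ m * [-1]^ n        ≡⟨ cong (_* [-1]^ n) ([-1]^-suc m) ⟨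
     [-1]^ (1ℤ + m) * [-1]^ n   ∎)
  (λ m h → ℤ.neg-injective (begin
     - [-1]^ (m + n)            ≡⟨ shift m ⟨
     [-1]^ (1ℤ + m + n)         ≡⟨ h ⟩
     [-1]^ (1ℤ + m) * [-1]^ n   ≡⟨ cong (_* [-1]^ n) ([-1]^-suc m) ⟩
     - [-1]^ m * [-1]^ n        ≡⟨ ℤ.neg-distribˡ-* ([-1]^ m) _ ⟨
     - ([-1]^ m * [-1]^ n)      ∎))
  m
  where
  open ≡-Reasoning
  shift : ∀ m → [-1]^ (1ℤ + m + n) ≡ - [-1]^ (m + n)
  shift m = trans (cong [-1]^_ (ℤ.+-assoc 1ℤ m n)) ([-1]^-suc (m + n))

-- Turns the sign of a summand into a power of `[-1]^ q`, which can then be absorbed into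
-- `w ^ (n ∸ k)`.
[-1]^-*+ : ∀ m n → [-1]^ (m * + n) ≡ ([-1]^ m) ^ n
[-1]^-*+ m zero    = cong [-1]^_ (ℤ.*-zeroʳ m)
[-1]^-*+ m (suc n) = begin
  [-1]^ (m * + suc n)         ≡⟨ cong [-1]^_ (ℤ.*-suc m (+ n)) ⟩
  [-1]^ (m + m * + n)         ≡⟨ [-1]^-+ m (m * + n) ⟩
  [-1]^ m * [-1]^ (m * + n)   ≡⟨ cong ([-1]^ m *_) ([-1]^-*+ m n) ⟩
  [-1]^ m * ([-1]^ m) ^ n     ∎
  where open ≡-Reasoning

-- Being a record type, `FibLike G` determines `G` in unification, so `G` can stay implicit.
record FibLike (G : ℤ → ℤ) : Set where
  field
    recurrence : ∀ m → G (1ℤ + (1ℤ + m)) ≡ G (1ℤ + m) + G m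

open FibLike

module _ {G : ℤ → ℤ} (G-fib : FibLike G) where

  fibLike-+ʳ : ∀ n → FibLike (λ m → G (m + n))
  recurrence (fibLike-+ʳ n) m = begin
    G (1ℤ + (1ℤ + m) + n)                  ≡⟨ cong G (e₂ m n) ⟩
    G (1ℤ + (1ℤ + (m + n)))                ≡⟨ recurrence G-fib (m + n) ⟩
    G (1ℤ + (m + n)) + G (m + n)           ≡⟨ cong (λ i → G i + G (m + n)) (ℤ.+-assoc 1ℤ m n) ⟨
    G (1ℤ + m + n) + G (m + n)             ∎
    where
    open ≡-Reasoning
    e₂ : ∀ m n → 1ℤ + (1ℤ + m) + n ≡ 1ℤ + (1ℤ + (m + n))
    e₂ = solve-∀

  fibLike-+ˡ : ∀ n → FibLike (λ m → G (n + m))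
  recurrence (fibLike-+ˡ n) m rewrite ℤ.+-comm n (1ℤ + (1ℤ + m)) | ℤ.+-comm n (1ℤ + m) | ℤ.+-comm n m =
    recurrence (fibLike-+ʳ n) m

  fibLike-*ˡ : ∀ c → FibLike (λ m → c * G m)
  recurrence (fibLike-*ˡ c) m rewrite recurrence G-fib m = ℤ.*-distribˡ-+ c (G (1ℤ + m)) (G m)

  fibLike-*ʳ : ∀ c → FibLike (λ m → G m * c)
  recurrence (fibLike-*ʳ c) m rewrite recurrence G-fib m = ℤ.*-distribʳ-+ c (G (1ℤ + m)) (G m)

  -- Read backwards, the recurrence says that a value is the difference of the next two; the
  -- alternating sign turns this difference into a sum again.
  fibLike-reflect : ∀ n → FibLike (λ m → [-1]^ m * G (n - m))
  recurrence (fibLike-reflect n) m = begin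
    [-1]^ (1ℤ + (1ℤ + m)) * G k
      ≡⟨ cong (_* G k) (trans ([-1]^-suc (1ℤ + m)) (cong -_ ([-1]^-suc m))) ⟩
    - - [-1]^ m * G k
      ≡⟨ ring ([-1]^ m) (G (1ℤ + k)) (G k) ⟩
    - [-1]^ m * G (1ℤ + k) + [-1]^ m * (G (1ℤ + k) + G k)
      ≡⟨ cong (λ g → - [-1]^ m * G (1ℤ + k) + [-1]^ m * g) (recurrence G-fib k) ⟨
    - [-1]^ m * G (1ℤ + k) + [-1]^ m * G (1ℤ + (1ℤ + k))
      ≡⟨ cong₂ (λ i j → - [-1]^ m * G i + [-1]^ m * G j) (e₁ n m) (e₂ n m) ⟨
    - [-1]^ m * G (n - (1ℤ + m)) + [-1]^ m * G (n - m)
      ≡⟨ cong (λ s → s * G (n - (1ℤ + m)) + [-1]^ m * G (n - m)) ([-1]^-suc m) ⟨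
    [-1]^ (1ℤ + m) * G (n - (1ℤ + m)) + [-1]^ m * G (n - m) ∎
    where
    open ≡-Reasoning
    k = n - (1ℤ + (1ℤ + m))
    e₁ : ∀ n m → n - (1ℤ + m) ≡ 1ℤ + (n - (1ℤ + (1ℤ + m)))
    e₁ = solve-∀
    e₂ : ∀ n m → n - m ≡ 1ℤ + (1ℤ + (n - (1ℤ + (1ℤ + m))))
    e₂ = solve-∀
    ring : ∀ s a b → - - s * b ≡ - s * a + s * (a + b)
    ring = solve-∀

  module _ {H : ℤ → ℤ} (H-fib : FibLike H) where

    fibLike-+ : FibLike (λ m → G m + H m)
    recurrence fibLike-+ m rewrite recurrence G-fib m | recurrence H-fib m =
      ring (G (1ℤ + m)) (G m) (H (1ℤ + m)) (H m)
      where
      ring : ∀ a b c d → a + b + (c + d) ≡ a + c + (b + d)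
      ring = solve-∀

    fibLike-- : FibLike (λ m → G m - H m)
    recurrence fibLike-- m rewrite recurrence G-fib m | recurrence H-fib m =
      ring (G (1ℤ + m)) (G m) (H (1ℤ + m)) (H m)
      where
      ring : ∀ a b c d → a + b - (c + d) ≡ a - c + (b - d)
      ring = solve-∀

    -- The induction carries two consecutive values; downwards, `G m` is recovered by cancelling
    -- `G (1ℤ + m)` in the recurrence. Identities linear in such sequences are thereby reduced to
    -- the indices 0 and 1.
    fibLike-unique : G 0ℤ ≡ H 0ℤ → G 1ℤ ≡ H 1ℤ → ∀ m → G m ≡ H m
    fibLike-unique eq₀ eq₁ m = proj₁ (ℤ-induction (λ m → G m ≡ H m × G (1ℤ + m) ≡ H (1ℤ + m))
      (eq₀ , eq₁)
      (λ m (h₀ , h₁) → h₁ , trans (recurrence G-fib m) (trans (cong₂ _+_ h₁ h₀) (sym (recurrence H-fib m))))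
      (λ m (h₁ , h₂) → +-cancelˡ (G (1ℤ + m)) _ _ (begin
         G (1ℤ + m) + G m     ≡⟨ recurrence G-fib m ⟨
         G (1ℤ + (1ℤ + m))    ≡⟨ h₂ ⟩
         H (1ℤ + (1ℤ + m))    ≡⟨ recurrence H-fib m ⟩
         H (1ℤ + m) + H m     ≡⟨ cong (_+ H m) h₁ ⟨
         G (1ℤ + m) + H m     ∎) , h₁)
      m)
      where open ≡-Reasoning

-- The sequences `F` and `L`

F-fib : FibLike F
recurrence F-fib (+ n)              = refl
-- For `m` equal to -1 or -2 the three indices include 0 and all values are numerals; further down,
-- the recurrence of `fib` is read with alternating signs.
recurrence F-fib -[1+ 0 ]           = refl
recurrence F-fib -[1+ 1 ]           = refl
recurrence F-fib -[1+ suc (suc n) ] = ring ([-1]^ (+ n)) (+ fib (suc n)) (+ fib (suc (suc n)))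
  where
  ring : ∀ e a b → e * a ≡ (-1ℤ * e) * b + (-1ℤ * (-1ℤ * e)) * (b + a)
  ring = solve-∀

L-fib : FibLike L
recurrence L-fib (+ n)              = refl
recurrence L-fib -[1+ 0 ]           = refl
recurrence L-fib -[1+ 1 ]           = refl
recurrence L-fib -[1+ suc (suc n) ] = ring ([-1]^ (+ suc n)) (+ luc (suc n)) (+ luc (suc (suc n)))
  where
  ring : ∀ e a b → e * a ≡ (-1ℤ * e) * b + (-1ℤ * (-1ℤ * e)) * (b + a)
  ring = solve-∀

-- The operator taking `G m` to `+ 2 * G (1ℤ + m) - G m` sends `F` to `L` and, by `5F-via-L`, `L` to
-- `5F`. It is the operator on the right-hand side of `L-addition`.
L-via-F : ∀ m → L m ≡ + 2 * F (1ℤ + m) - F m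
L-via-F = fibLike-unique L-fib
  (fibLike-- (fibLike-*ˡ (fibLike-+ˡ F-fib 1ℤ) (+ 2)) F-fib) refl refl

5F-via-L : ∀ m → + 5 * F m ≡ + 2 * L (1ℤ + m) - L m
5F-via-L = fibLike-unique (fibLike-*ˡ F-fib (+ 5))
  (fibLike-- (fibLike-*ˡ (fibLike-+ˡ L-fib 1ℤ) (+ 2)) L-fib) refl refl

-- Addition and multiplication formulas

module _ {G : ℤ → ℤ} (G-fib : FibLike G) where

  -- The left-hand side is a 2 by 2 determinant of consecutive values of `F` and `G`. A step of both
  -- recurrences only changes its sign, and at `n = 0` it is `G m`.
  cassini : ∀ m n → F (1ℤ + n) * G (m + n) - F n * G (m + (1ℤ + n)) ≡ [-1]^ n * G m
  cassini m = ℤ-induction _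
    base
    (λ n h → trans (step n) (trans (cong -_ h) (negate n)))
    (λ n h → ℤ.neg-injective (trans (sym (step n)) (trans h (sym (negate n)))))
    where
    D : ℤ → ℤ
    D n = F (1ℤ + n) * G (m + n) - F n * G (m + (1ℤ + n))
    base : D 0ℤ ≡ 1ℤ * G m
    base rewrite ℤ.+-identityʳ m = ℤ.+-identityʳ (1ℤ * G m)
    ring : ∀ a b c d → (a + b) * c - a * (c + d) ≡ - (a * d - b * c)
    ring = solve-∀
    step : ∀ n → D (1ℤ + n) ≡ - D n
    step n = trans
      (cong₂ (λ a b → a * G (m + (1ℤ + n)) - F (1ℤ + n) * b)
        (recurrence F-fib n) (recurrence (fibLike-+ˡ G-fib m) n))
      (ring (F (1ℤ + n)) (F n) (G (m + (1ℤ + n))) (G (m + n)))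
    negate : ∀ n → - ([-1]^ n * G m) ≡ [-1]^ (1ℤ + n) * G m
    negate n rewrite [-1]^-suc n = ℤ.neg-distribˡ-* ([-1]^ n) (G m)

  -- Both sides are Fibonacci-like in `p`. At `p = 0` the second term vanishes, and `p = 1` is
  -- `cassini`.
  F-addition : ∀ p q m → F (p + q) * G (m + q) - [-1]^ q * F p * G m ≡ F q * G (m + (p + q))
  F-addition p q m = fibLike-unique
    (fibLike-- (fibLike-*ʳ (fibLike-+ʳ F-fib q) (G (m + q)))
               (fibLike-*ʳ (fibLike-*ˡ F-fib ([-1]^ q)) (G m)))
    (fibLike-*ˡ (fibLike-+ʳ (fibLike-+ˡ G-fib m) q) (F q))
    at0 at1 p
    where
    ring₀ : ∀ a b s → a - s * 0ℤ * b ≡ a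
    ring₀ = solve-∀
    ring₁ : ∀ a b s c → a - c ≡ s * b → a - s * 1ℤ * b ≡ c
    ring₁ a b s c h = trans (e₁ a b s) (trans (cong (λ d → a - d) (sym h)) (e₂ a c))
      where
      e₁ : ∀ a b s → a - s * 1ℤ * b ≡ a - s * b
      e₁ = solve-∀
      e₂ : ∀ a c → a - (a - c) ≡ c
      e₂ = solve-∀
    at0 : F (0ℤ + q) * G (m + q) - [-1]^ q * F 0ℤ * G m ≡ F q * G (m + (0ℤ + q))
    at0 rewrite ℤ.+-identityˡ q = ring₀ _ (G m) ([-1]^ q)
    at1 : F (1ℤ + q) * G (m + q) - [-1]^ q * F 1ℤ * G m ≡ F q * G (m + (1ℤ + q))
    at1 = ring₁ (F (1ℤ + q) * G (m + q)) (G m) ([-1]^ q) _ (cassini m q)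

  -- By `L-via-F` this is twice `F-addition` at `1ℤ + p` minus `F-addition` at `p`.
  L-addition : ∀ p q m → L (p + q) * G (m + q) - [-1]^ q * L p * G m ≡
               F q * (+ 2 * G (1ℤ + (m + (p + q))) - G (m + (p + q)))
  L-addition p q m rewrite L-via-F (p + q) | L-via-F p = begin
    (+ 2 * F (1ℤ + (p + q)) - F (p + q)) * G (m + q) - [-1]^ q * (+ 2 * F (1ℤ + p) - F p) * G m
      ≡⟨ cong (λ i → (+ 2 * F i - F (p + q)) * G (m + q) - [-1]^ q * (+ 2 * F (1ℤ + p) - F p) * G m)
           (ℤ.+-assoc 1ℤ p q) ⟨
    (+ 2 * F (1ℤ + p + q) - F (p + q)) * G (m + q) - [-1]^ q * (+ 2 * F (1ℤ + p) - F p) * G m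
      ≡⟨ ring₁ (F (1ℤ + p + q)) (F (p + q)) (G (m + q)) ([-1]^ q) (F (1ℤ + p)) (F p) (G m) ⟩
    + 2 * (F (1ℤ + p + q) * G (m + q) - [-1]^ q * F (1ℤ + p) * G m)
      - (F (p + q) * G (m + q) - [-1]^ q * F p * G m)
      ≡⟨ cong₂ (λ a b → + 2 * a - b) (F-addition (1ℤ + p) q m) (F-addition p q m) ⟩
    + 2 * (F q * G (m + (1ℤ + p + q))) - F q * G (m + (p + q))
      ≡⟨ cong (λ i → + 2 * (F q * G i) - F q * G (m + (p + q))) (index m p q) ⟩
    + 2 * (F q * G (1ℤ + (m + (p + q)))) - F q * G (m + (p + q))
      ≡⟨ ring₂ (F q) _ _ ⟩
    F q * (+ 2 * G (1ℤ + (m + (p + q))) - G (m + (p + q))) ∎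
    where
    open ≡-Reasoning
    index : ∀ m p q → m + (1ℤ + p + q) ≡ 1ℤ + (m + (p + q))
    index = solve-∀
    ring₁ : ∀ a b c s d e g → (+ 2 * a - b) * c - s * (+ 2 * d - e) * g ≡
            + 2 * (a * c - s * d * g) - (b * c - s * e * g)
    ring₁ = solve-∀
    ring₂ : ∀ a b c → + 2 * (a * b) - a * c ≡ a * (+ 2 * b - c)
    ring₂ = solve-∀

  -- Both sides are Fibonacci-like in `q`, the last term by `fibLike-reflect`; `q = 1` is the
  -- recurrence of `G`.
  L-multiplication : ∀ q m → L q * G m ≡ G (m + q) + [-1]^ q * G (m - q)
  L-multiplication q m = fibLike-unique (fibLike-*ʳ L-fib (G m))
    (fibLike-+ (fibLike-+ˡ G-fib m) (fibLike-reflect G-fib m))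
    at0 at1 q
    where
    ring₀ : ∀ a → + 2 * a ≡ a + 1ℤ * a
    ring₀ = solve-∀
    at0 : + 2 * G m ≡ G (m + 0ℤ) + 1ℤ * G (m - 0ℤ)
    at0 rewrite ℤ.+-identityʳ m = ring₀ (G m)
    ring₁ : ∀ a b → 1ℤ * a ≡ a + b + (-1ℤ) * b
    ring₁ = solve-∀
    e₁ : ∀ m → m + 1ℤ ≡ 1ℤ + (1ℤ + (m - 1ℤ))
    e₁ = solve-∀
    e₂ : ∀ m → 1ℤ + (m - 1ℤ) ≡ m
    e₂ = solve-∀
    G-suc : G (m + 1ℤ) ≡ G m + G (m - 1ℤ)
    G-suc = trans (cong G (e₁ m))
      (trans (recurrence G-fib (m - 1ℤ)) (cong (λ i → G i + G (m - 1ℤ)) (e₂ m)))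
    at1 : 1ℤ * G m ≡ G (m + 1ℤ) + [-1]^ 1ℤ * G (m - 1ℤ)
    at1 = trans (ring₁ (G m) (G (m - 1ℤ)))
      (cong (_+ [-1]^ 1ℤ * G (m - 1ℤ)) (sym G-suc))

-- Sums of binomial coefficients

∑< : ℕ → (ℕ → ℤ) → ℤ
∑< zero    f = 0ℤ
∑< (suc n) f = ∑< n f + f n

∑<-cong : ∀ n {f g : ℕ → ℤ} → (∀ j → f j ≡ g j) → ∑< n f ≡ ∑< n g
∑<-cong zero    f≗g = refl
∑<-cong (suc n) f≗g = cong₂ _+_ (∑<-cong n f≗g) (f≗g n)

∑<-+ : ∀ n (f g : ℕ → ℤ) → ∑< n (λ j → f j + g j) ≡ ∑< n f + ∑< n g
∑<-+ zero    f g = refl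
∑<-+ (suc n) f g rewrite ∑<-+ n f g = ring (∑< n f) (∑< n g) (f n) (g n)
  where
  ring : ∀ a b c d → a + b + (c + d) ≡ a + c + (b + d)
  ring = solve-∀

∑<-*ˡ : ∀ n c (f : ℕ → ℤ) → ∑< n (λ j → c * f j) ≡ c * ∑< n f
∑<-*ˡ zero    c f = sym (ℤ.*-zeroʳ c)
∑<-*ˡ (suc n) c f rewrite ∑<-*ˡ n c f = sym (ℤ.*-distribˡ-+ c (∑< n f) (f n))

∑<-head : ∀ n (f : ℕ → ℤ) → ∑< (suc n) f ≡ f 0 + ∑< n (f ∘ suc)
∑<-head zero    f = ℤ.+-comm 0ℤ (f 0)
∑<-head (suc n) f rewrite ∑<-head n f = ℤ.+-assoc (f 0) (∑< n (f ∘ suc)) (f (suc n))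

pascal : ∀ n k → + (suc n C suc k) ≡ + (n C suc k) + + (n C k)
pascal n k = trans (cong +_ (sym (nCk+nC[k+1]≡[n+1]C[k+1] n k)))
  (ℤ.+-comm (+ (n C k)) (+ (n C suc k)))

module BinomialSums (w : ℤ) where

  -- The index j stands for k - 1, so that odd n j belongs to C(n+k-1, 2k-1) w^(n-k).
  odd even : ℕ → ℕ → ℤ
  odd  n j = + ((n ℕ.+ j) C suc (2 ℕ.* j)) * w ^ (n ∸ suc j)
  even n j = + ((n ℕ.+ j) C (2 ℕ.* j)) * w ^ (n ∸ j)

  j+j<1+2j : ∀ j → j ℕ.+ j ℕ.< suc (2 ℕ.* j)
  j+j<1+2j j = ℕ.≤-reflexive (cong (λ i → suc (j ℕ.+ i)) (sym (ℕ.+-identityʳ j)))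

  odd-vanishes : ∀ {n} j → n ℕ.≤ j → (n ℕ.+ j) C suc (2 ℕ.* j) ≡ 0
  odd-vanishes j n≤j = k>n⇒nCk≡0 (ℕ.≤-<-trans (ℕ.+-monoˡ-≤ j n≤j) (j+j<1+2j j))

  even-vanishes : ∀ {n} j → n ℕ.≤ j → (n ℕ.+ suc j) C (2 ℕ.* suc j) ≡ 0
  even-vanishes {n} j n≤j = k>n⇒nCk≡0
    (ℕ.≤-trans (ℕ.≤-reflexive (cong suc (ℕ.+-suc n j)))
      (ℕ.≤-trans (ℕ.s≤s (ℕ.s≤s (ℕ.+-monoˡ-≤ j n≤j))) (ℕ.≤-reflexive (e j))))
    where
    e : ∀ j → suc (suc (j ℕ.+ j)) ≡ 2 ℕ.* suc j
    e = ℕ-Solver.solve-∀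

  -- For n ≤ j the truncated exponents n ∸ suc j and n ∸ j agree, but then the
  -- binomial coefficient c is 0.
  raise : ∀ n j c → (n ℕ.≤ j → c ≡ 0) → w * (+ c * w ^ (n ∸ suc j)) ≡ + c * w ^ (n ∸ j)
  raise n j c vanish with j ℕ.<? n
  ... | yes j<n = trans (ring w (+ c) _)
                    (cong (λ i → + c * w ^ i) (sym (ℕ.+-∸-assoc 1 j<n)))
    where
    ring : ∀ w c v → w * (c * v) ≡ c * (w * v)
    ring = solve-∀
  ... | no  j≮n rewrite vanish (ℕ.≮⇒≥ j≮n) =
    trans (cong (w *_) (ℤ.*-zeroˡ (w ^ (n ∸ suc j))))
      (trans (ℤ.*-zeroʳ w) (sym (ℤ.*-zeroˡ (w ^ (n ∸ j)))))

  -- Pascal's rule in row `suc (n ℕ.+ j)`. In `even-suc` the row below is `n ℕ.+ suc j`, which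
  -- equals `suc n ℕ.+ j`, so that the second entry belongs to `odd (suc n)` and not to `odd n`.
  odd-suc : ∀ n j → odd (suc n) j ≡ w * odd n j + even n j
  odd-suc n j = begin
    + (suc (n ℕ.+ j) C suc (2 ℕ.* j)) * w ^ (n ∸ j)
      ≡⟨ cong (_* w ^ (n ∸ j)) (pascal (n ℕ.+ j) (2 ℕ.* j)) ⟩
    (+ ((n ℕ.+ j) C suc (2 ℕ.* j)) + + ((n ℕ.+ j) C (2 ℕ.* j))) * w ^ (n ∸ j)
      ≡⟨ ℤ.*-distribʳ-+ (w ^ (n ∸ j)) (+ ((n ℕ.+ j) C suc (2 ℕ.* j))) (+ ((n ℕ.+ j) C (2 ℕ.* j))) ⟩
    + ((n ℕ.+ j) C suc (2 ℕ.* j)) * w ^ (n ∸ j) + even n j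
      ≡⟨ cong (_+ even n j) (raise n j _ (odd-vanishes j)) ⟨
    w * odd n j + even n j ∎
    where open ≡-Reasoning

  even-suc : ∀ n j → even (suc n) (suc j) ≡ w * even n (suc j) + odd (suc n) j
  even-suc n j = begin
    + (suc (n ℕ.+ suc j) C (2 ℕ.* suc j)) * w ^ (n ∸ j)
      -- `2 ℕ.* suc j` reduces to the successor of `j ℕ.+ suc (j ℕ.+ 0)`.
      ≡⟨ cong (_* w ^ (n ∸ j)) (pascal (n ℕ.+ suc j) (j ℕ.+ suc (j ℕ.+ 0))) ⟩
    (+ ((n ℕ.+ suc j) C (2 ℕ.* suc j)) + + ((n ℕ.+ suc j) C (j ℕ.+ suc (j ℕ.+ 0)))) * w ^ (n ∸ j)
      ≡⟨ ℤ.*-distribʳ-+ (w ^ (n ∸ j)) (+ ((n ℕ.+ suc j) C (2 ℕ.* suc j)))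
           (+ ((n ℕ.+ suc j) C (j ℕ.+ suc (j ℕ.+ 0)))) ⟩
    + ((n ℕ.+ suc j) C (2 ℕ.* suc j)) * w ^ (n ∸ j)
      + + ((n ℕ.+ suc j) C (j ℕ.+ suc (j ℕ.+ 0))) * w ^ (n ∸ j)
      ≡⟨ cong₂ _+_ (sym (raise n j _ (even-vanishes j)))
           (cong₂ (λ a b → + (a C b) * w ^ (n ∸ j)) (ℕ.+-suc n j) (ℕ.+-suc j (j ℕ.+ 0))) ⟩
    w * even n (suc j) + odd (suc n) j ∎
    where open ≡-Reasoning

  -- The ranges differ because `even n n` is 1, whereas `odd n n` is 0.
  oddSum evenSum : ℕ → (ℕ → ℤ) → ℤ
  oddSum  n Z = ∑< n       (λ j → odd n j * Z j)
  evenSum n Z = ∑< (suc n) (λ j → even n j * Z j)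

  distribute : ∀ n (a b c Z : ℕ → ℤ) → (∀ j → c j ≡ w * a j + b j) →
    ∑< n (λ j → c j * Z j) ≡ w * ∑< n (λ j → a j * Z j) + ∑< n (λ j → b j * Z j)
  distribute n a b c Z c≗ = begin
    ∑< n (λ j → c j * Z j)
      ≡⟨ ∑<-cong n (λ j → trans (cong (_* Z j) (c≗ j)) (ring w (a j) (b j) (Z j))) ⟩
    ∑< n (λ j → w * (a j * Z j) + b j * Z j)
      ≡⟨ ∑<-+ n _ _ ⟩
    ∑< n (λ j → w * (a j * Z j)) + ∑< n (λ j → b j * Z j)
      ≡⟨ cong (_+ ∑< n (λ j → b j * Z j)) (∑<-*ˡ n w _) ⟩
    w * ∑< n (λ j → a j * Z j) + ∑< n (λ j → b j * Z j) ∎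
    where
    open ≡-Reasoning
    ring : ∀ w a b z → (w * a + b) * z ≡ w * (a * z) + b * z
    ring = solve-∀

  drop-last : ∀ s c v z → c ≡ 0 → s + + c * v * z ≡ s
  drop-last s c v z refl = ring s v z
    where
    ring : ∀ s v z → s + 0ℤ * v * z ≡ s
    ring = solve-∀

  oddSum-suc : ∀ n Z → oddSum (suc n) Z ≡ w * oddSum n Z + evenSum n Z
  oddSum-suc n Z = begin
    oddSum (suc n) Z
      ≡⟨ distribute (suc n) (odd n) (even n) (odd (suc n)) Z (odd-suc n) ⟩
    w * (oddSum n Z + odd n n * Z n) + evenSum n Z
      ≡⟨ cong (λ i → w * i + evenSum n Z)
           (drop-last (oddSum n Z) _ _ (Z n) (odd-vanishes n ℕ.≤-refl)) ⟩
    w * oddSum n Z + evenSum n Z ∎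
    where open ≡-Reasoning

  evenSum-suc : ∀ n Z → evenSum (suc n) Z ≡ w * evenSum n Z + oddSum (suc n) (Z ∘ suc)
  evenSum-suc n Z = begin
    evenSum (suc n) Z
      -- `even-suc` concerns positive indices; the term at index 0 has binomial coefficient 1 and
      -- merely gains a factor `w`.
      ≡⟨ ∑<-head (suc n) _ ⟩
    1ℤ * w ^ suc n * Z 0 + ∑< (suc n) (λ j → even (suc n) (suc j) * Z (suc j))
      ≡⟨ cong (λ i → 1ℤ * w ^ suc n * Z 0 + i)
           (distribute (suc n) (even n ∘ suc) (odd (suc n)) (even (suc n) ∘ suc) (Z ∘ suc) (even-suc n)) ⟩
    1ℤ * (w * w ^ n) * Z 0 + (w * tail + oddSum (suc n) (Z ∘ suc))
      ≡⟨ ring w (w ^ n) (Z 0) tail _ ⟩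
    w * (1ℤ * w ^ n * Z 0 + tail) + oddSum (suc n) (Z ∘ suc)
      ≡⟨ cong (λ i → w * i + oddSum (suc n) (Z ∘ suc)) (∑<-head (suc n) (λ j → even n j * Z j)) ⟨
    w * (evenSum n Z + even n (suc n) * Z (suc n)) + oddSum (suc n) (Z ∘ suc)
      ≡⟨ cong (λ i → w * i + oddSum (suc n) (Z ∘ suc))
           (drop-last (evenSum n Z) _ _ (Z (suc n)) (even-vanishes n ℕ.≤-refl)) ⟩
    w * evenSum n Z + oddSum (suc n) (Z ∘ suc) ∎
    where
    open ≡-Reasoning
    tail = ∑< (suc n) (λ j → even n (suc j) * Z (suc j))
    ring : ∀ w v z a b → 1ℤ * (w * v) * z + (w * a + b) ≡ w * (1ℤ * v * z + a) + b
    ring = solve-∀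

  -- Eliminates `evenSum` between `oddSum-suc` and `evenSum-suc`. Multiplication by `z` appears as
  -- the shift `Z ∘ suc`, and the `w * w` term is kept on the left to avoid subtraction.
  oddSum-recurrence : ∀ n Z → oddSum (2 ℕ.+ n) Z + w * w * oddSum n Z ≡
                      + 2 * w * oddSum (suc n) Z + oddSum (suc n) (Z ∘ suc)
  oddSum-recurrence n Z = begin
    oddSum (2 ℕ.+ n) Z + w * w * oddSum n Z
      ≡⟨ cong (_+ w * w * oddSum n Z) (oddSum-suc (suc n) Z) ⟩
    w * oddSum (suc n) Z + evenSum (suc n) Z + w * w * oddSum n Z
      ≡⟨ cong (λ i → w * oddSum (suc n) Z + i + w * w * oddSum n Z) (evenSum-suc n Z) ⟩
    w * oddSum (suc n) Z + (w * evenSum n Z + oddSum (suc n) (Z ∘ suc)) + w * w * oddSum n Z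
      ≡⟨ ring₁ w (oddSum (suc n) Z) (evenSum n Z) _ (oddSum n Z) ⟩
    w * oddSum (suc n) Z + w * (w * oddSum n Z + evenSum n Z) + oddSum (suc n) (Z ∘ suc)
      ≡⟨ cong (λ i → w * oddSum (suc n) Z + w * i + oddSum (suc n) (Z ∘ suc)) (oddSum-suc n Z) ⟨
    w * oddSum (suc n) Z + w * oddSum (suc n) Z + oddSum (suc n) (Z ∘ suc)
      ≡⟨ ring₂ w (oddSum (suc n) Z) _ ⟩
    + 2 * w * oddSum (suc n) Z + oddSum (suc n) (Z ∘ suc) ∎
    where
    open ≡-Reasoning
    ring₁ : ∀ w a b c d → w * a + (w * b + c) + w * w * d ≡ w * a + w * (w * d + b) + c
    ring₁ = solve-∀
    ring₂ : ∀ w a c → w * a + w * a + c ≡ + 2 * w * a + c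
    ring₂ = solve-∀

  oddSum-cong : ∀ n {Z Z′ : ℕ → ℤ} → (∀ j → Z j ≡ Z′ j) → oddSum n Z ≡ oddSum n Z′
  oddSum-cong n Z≗Z′ = ∑<-cong n (λ j → cong (odd n j *_) (Z≗Z′ j))

  oddSum-*ˡ : ∀ n c (Z : ℕ → ℤ) → oddSum n (λ j → c * Z j) ≡ c * oddSum n Z
  oddSum-*ˡ n c Z = trans (∑<-cong n (λ j → ring (odd n j) c (Z j))) (∑<-*ˡ n c _)
    where
    ring : ∀ a c z → a * (c * z) ≡ c * (a * z)
    ring = solve-∀

-- The weights k/(n+k)

[1+k]*[1+n]C[1+k]≡[1+n]*nCk : ∀ n k → suc k ℕ.* (suc n C suc k) ≡ suc n ℕ.* (n C k)
[1+k]*[1+n]C[1+k]≡[1+n]*nCk n zero = trans (ℕ.*-identityˡ _)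
  (trans (nC1≡n (suc n)) (sym (ℕ.*-identityʳ (suc n))))
[1+k]*[1+n]C[1+k]≡[1+n]*nCk zero (suc k) = ℕ.*-zeroʳ k
[1+k]*[1+n]C[1+k]≡[1+n]*nCk (suc n) (suc k) = begin
  (2 ℕ.+ k) ℕ.* ((2 ℕ.+ n) C (2 ℕ.+ k))
    ≡⟨ cong ((2 ℕ.+ k) ℕ.*_) (nCk+nC[k+1]≡[n+1]C[k+1] (suc n) (suc k)) ⟨
  (2 ℕ.+ k) ℕ.* (a ℕ.+ (suc n C (2 ℕ.+ k)))
    ≡⟨ ring₁ k a _ ⟩
  a ℕ.+ suc k ℕ.* a ℕ.+ (2 ℕ.+ k) ℕ.* (suc n C (2 ℕ.+ k))
    ≡⟨ cong₂ (λ i j → a ℕ.+ i ℕ.+ j)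
         ([1+k]*[1+n]C[1+k]≡[1+n]*nCk n k) ([1+k]*[1+n]C[1+k]≡[1+n]*nCk n (suc k)) ⟩
  a ℕ.+ suc n ℕ.* (n C k) ℕ.+ suc n ℕ.* (n C suc k)
    ≡⟨ ring₂ n a _ _ ⟩
  a ℕ.+ suc n ℕ.* ((n C k) ℕ.+ (n C suc k))
    ≡⟨ cong (λ i → a ℕ.+ suc n ℕ.* i) (nCk+nC[k+1]≡[n+1]C[k+1] n k) ⟩
  (2 ℕ.+ n) ℕ.* a ∎
  where
  open ≡-Reasoning
  a = suc n C suc k
  ring₁ : ∀ k a b → (2 ℕ.+ k) ℕ.* (a ℕ.+ b) ≡ a ℕ.+ suc k ℕ.* a ℕ.+ (2 ℕ.+ k) ℕ.* b
  ring₁ = ℕ-Solver.solve-∀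
  ring₂ : ∀ n a b c → a ℕ.+ suc n ℕ.* b ℕ.+ suc n ℕ.* c ≡ a ℕ.+ suc n ℕ.* (b ℕ.+ c)
  ring₂ = ℕ-Solver.solve-∀

-- The identity k/(n+k) · C(n+k, n-k) = C(n+k-1, 2k-1)/2 at `k = suc j`, with denominators cleared:
-- symmetry gives C(n+k, 2k), to which the absorption identity applies.
weight-binomial : ∀ n j → j ℕ.< n →
  2 ℕ.* suc j ℕ.* ((n ℕ.+ suc j) C (n ∸ suc j)) ≡ (n ℕ.+ suc j) ℕ.* ((n ℕ.+ j) C suc (2 ℕ.* j))
weight-binomial n j j<n = begin
  2 ℕ.* suc j ℕ.* ((n ℕ.+ suc j) C (n ∸ suc j))
    ≡⟨ cong (λ i → 2 ℕ.* suc j ℕ.* ((n ℕ.+ suc j) C i)) complement ⟨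
  2 ℕ.* suc j ℕ.* ((n ℕ.+ suc j) C (n ℕ.+ suc j ∸ 2 ℕ.* suc j))
    ≡⟨ cong (2 ℕ.* suc j ℕ.*_) (nCk≡nC[n∸k] bound) ⟨
  2 ℕ.* suc j ℕ.* ((n ℕ.+ suc j) C (2 ℕ.* suc j))
    ≡⟨ cong₂ (λ a b → b ℕ.* (a C b)) (ℕ.+-suc n j) (double j) ⟩
  (2 ℕ.+ 2 ℕ.* j) ℕ.* (suc (n ℕ.+ j) C (2 ℕ.+ 2 ℕ.* j))
    ≡⟨ [1+k]*[1+n]C[1+k]≡[1+n]*nCk (n ℕ.+ j) (suc (2 ℕ.* j)) ⟩
  suc (n ℕ.+ j) ℕ.* ((n ℕ.+ j) C suc (2 ℕ.* j))
    ≡⟨ cong (ℕ._* ((n ℕ.+ j) C suc (2 ℕ.* j))) (ℕ.+-suc n j) ⟨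
  (n ℕ.+ suc j) ℕ.* ((n ℕ.+ j) C suc (2 ℕ.* j)) ∎
  where
  open ≡-Reasoning
  double : ∀ j → 2 ℕ.* suc j ≡ 2 ℕ.+ 2 ℕ.* j
  double = ℕ-Solver.solve-∀
  twice : 2 ℕ.* suc j ≡ suc j ℕ.+ suc j
  twice = cong (suc j ℕ.+_) (ℕ.+-identityʳ (suc j))
  complement : n ℕ.+ suc j ∸ 2 ℕ.* suc j ≡ n ∸ suc j
  complement = trans (cong (n ℕ.+ suc j ∸_) twice)
    (trans (sym (ℕ.∸-+-assoc (n ℕ.+ suc j) (suc j) (suc j)))
           (cong (_∸ suc j) (ℕ.m+n∸n≡m n (suc j))))
  bound : 2 ℕ.* suc j ℕ.≤ n ℕ.+ suc j
  bound = subst (ℕ._≤ n ℕ.+ suc j) (sym twice) (ℕ.+-monoˡ-≤ (suc j) j<n)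

-- The closed form over the integers

module ClosedForm
  {G Ĝ : ℤ → ℤ} {p q s x y f l e : ℤ}
  (s*s≡1 : s * s ≡ 1ℤ)
  (G-addition : ∀ m → x * G (m + q) - s * y * G m ≡ f * Ĝ (m + (p + q)))
  (Ĝ-addition : ∀ m → x * Ĝ (m + q) - s * y * Ĝ m ≡ f * (e * G (m + (p + q))))
  (G-multiplication : ∀ m → l * G m ≡ G (m + q) + s * G (m - q))
  where

  -- In the application `f` is `F q` and `l` is `L q`. The factor `e`, picked up on going from `G`
  -- to `Ĝ` and back, is 1 for U = F and 5 for U = L. `D` is half the denominator.
  w E r D : ℤ
  w = s * y * x
  E = e * (f * f)
  r = + 2 * p + q
  D = x ^ 2 + y * x * l + s * y ^ 2

  -- The bracket that occurs twice in the numerator, at `p + t + q * + n` and at `p + t - q * + n`.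
  H : ℤ → ℤ
  H m = x * G m + y * G (m + q)

  private
    m-q+q : ∀ m → m - q + q ≡ m
    m-q+q m = lemma m q
      where
      lemma : ∀ m q → m - q + q ≡ m
      lemma = solve-∀

  -- Let T be the shift by `q`. As s² = 1, the operator x² T + y² T⁻¹ - 2w is T⁻¹ (x T - s y)². One
  -- factor x T - s y leads from `G` to `Ĝ`, the other back to `G`.
  G-step : ∀ m → x * x * G (m + q) + y * y * G (m - q) ≡ + 2 * w * G m + E * G (m + r)
  G-step m = begin
    x * x * a + y * y * d
      ≡⟨ ring₁ (x * x * a) (y * y * d) ⟩
    x * x * a + 1ℤ * (y * y * d)
      ≡⟨ cong (λ i → x * x * a + i * (y * y * d)) s*s≡1 ⟨
    x * x * a + s * s * (y * y * d)
      ≡⟨ ring₂ s x y a b d ⟩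
    + 2 * (s * y * x) * b + (x * (x * a - s * y * b) - s * y * (x * b - s * y * d))
      ≡⟨ cong₂ (λ i j → + 2 * (s * y * x) * b + (x * i - s * y * j)) (G-addition m) lower ⟩
    + 2 * (s * y * x) * b + (x * (f * Ĝ (m + (p + q))) - s * y * (f * Ĝ (m + p)))
      ≡⟨ cong (λ i → + 2 * (s * y * x) * b + (x * (f * Ĝ i) - s * y * (f * Ĝ (m + p)))) (ℤ.+-assoc m p q) ⟨
    + 2 * (s * y * x) * b + (x * (f * Ĝ (m + p + q)) - s * y * (f * Ĝ (m + p)))
      ≡⟨ ring₃ (+ 2 * (s * y * x) * b) x f (Ĝ (m + p + q)) s y (Ĝ (m + p)) ⟩
    + 2 * (s * y * x) * b + f * (x * Ĝ (m + p + q) - s * y * Ĝ (m + p))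
      ≡⟨ cong (λ i → + 2 * (s * y * x) * b + f * i) (Ĝ-addition (m + p)) ⟩
    + 2 * (s * y * x) * b + f * (f * (e * G (m + p + (p + q))))
      ≡⟨ ring₄ (+ 2 * (s * y * x) * b) f e (G (m + p + (p + q))) ⟩
    + 2 * (s * y * x) * b + e * (f * f) * G (m + p + (p + q))
      ≡⟨ cong (λ i → + 2 * (s * y * x) * b + e * (f * f) * G i) (index₂ m p q) ⟩
    + 2 * w * b + E * G (m + r) ∎
    where
    open ≡-Reasoning
    a = G (m + q)
    b = G m
    d = G (m - q)
    index₁ : ∀ m p q → m - q + (p + q) ≡ m + p
    index₁ = solve-∀
    index₂ : ∀ m p q → m + p + (p + q) ≡ m + (+ 2 * p + q)
    index₂ = solve-∀
    lower : x * b - s * y * d ≡ f * Ĝ (m + p)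
    lower = trans (cong (λ i → x * G i - s * y * d) (sym (m-q+q m)))
      (trans (G-addition (m - q)) (cong (λ i → f * Ĝ i) (index₁ m p q)))
    ring₁ : ∀ a b → a + b ≡ a + 1ℤ * b
    ring₁ = solve-∀
    ring₂ : ∀ s x y a b d → x * x * a + s * s * (y * y * d) ≡
      + 2 * (s * y * x) * b + (x * (x * a - s * y * b) - s * y * (x * b - s * y * d))
    ring₂ = solve-∀
    ring₃ : ∀ k x f c s y c′ → k + (x * (f * c) - s * y * (f * c′)) ≡ k + f * (x * c - s * y * c′)
    ring₃ = solve-∀
    ring₄ : ∀ k f e g → k + f * (f * (e * g)) ≡ k + e * (f * f) * g
    ring₄ = solve-∀

  -- `H` combines `G` and its shift by `q` linearly, so `G-step` at `m` and at `m + q` suffices.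
  H-step : ∀ m → x * x * H (m + q) + y * y * H (m - q) ≡ + 2 * w * H m + E * H (m + r)
  H-step m = begin
    x * x * (x * G (m + q) + y * G (m + q + q)) + y * y * (x * G (m - q) + y * G (m - q + q))
      ≡⟨ cong (λ i → x * x * (x * G (m + q) + y * G (m + q + q)) + y * y * (x * G (m - q) + y * G i)) (swap₁ m q) ⟩
    x * x * (x * G (m + q) + y * G (m + q + q)) + y * y * (x * G (m - q) + y * G (m + q - q))
      ≡⟨ ring₁ x y (G (m + q)) (G (m + q + q)) (G (m - q)) (G (m + q - q)) ⟩
    x * (x * x * G (m + q) + y * y * G (m - q)) + y * (x * x * G (m + q + q) + y * y * G (m + q - q))
      ≡⟨ cong₂ (λ i j → x * i + y * j) (G-step m) (G-step (m + q)) ⟩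
    x * (+ 2 * w * G m + E * G (m + r)) + y * (+ 2 * w * G (m + q) + E * G (m + q + r))
      ≡⟨ ring₂ x y w E (G m) (G (m + r)) (G (m + q)) (G (m + q + r)) ⟩
    + 2 * w * H m + E * (x * G (m + r) + y * G (m + q + r))
      ≡⟨ cong (λ i → + 2 * w * H m + E * (x * G (m + r) + y * G i)) (swap₂ m q r) ⟩
    + 2 * w * H m + E * H (m + r) ∎
    where
    open ≡-Reasoning
    swap₁ : ∀ m q → m - q + q ≡ m + q - q
    swap₁ = solve-∀
    swap₂ : ∀ m q r → m + q + r ≡ m + r + q
    swap₂ = solve-∀
    ring₁ : ∀ x y a b c d → x * x * (x * a + y * b) + y * y * (x * c + y * d) ≡
      x * (x * x * a + y * y * c) + y * (x * x * b + y * y * d)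
    ring₁ = solve-∀
    ring₂ : ∀ x y w E a b c d → x * (+ 2 * w * a + E * b) + y * (+ 2 * w * c + E * d) ≡
      + 2 * w * (x * a + y * c) + E * (x * b + y * d)
    ring₂ = solve-∀

  -- This is the case `n = 1`. With T the shift by `q`, `G-multiplication` lets `l` act as T + s
  -- T⁻¹, hence `D` as (x + y T)(x + s y T⁻¹). The second factor times x T - s y is x² T - y² T⁻¹,
  -- and the first takes `G` to `H`.
  H-base : ∀ m → D * (f * Ĝ (m + (p + q))) ≡ x * x * H (m + q) - y * y * H (m - q)
  H-base m = begin
    D * (f * Ĝ (m + (p + q)))
      ≡⟨ cong (D *_) (G-addition m) ⟨
    (x * (x * 1ℤ) + y * x * l + s * (y * (y * 1ℤ))) * (x * a - s * y * b)
      ≡⟨ ring₁ x y l s a b ⟩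
    x * x * (x * a) + x * x * y * (l * a) + s * x * (y * y) * a - s * (x * x) * y * b
      - s * x * (y * y) * (l * b) - s * s * (y * (y * y) * b)
      ≡⟨ cong₂ (λ i j → x * x * (x * a) + x * x * y * i + s * x * (y * y) * a - s * (x * x) * y * b
           - s * x * (y * y) * j - s * s * (y * (y * y) * b))
           upper (G-multiplication m) ⟩
    x * x * (x * a) + x * x * y * (c + s * b) + s * x * (y * y) * a - s * (x * x) * y * b
      - s * x * (y * y) * (a + s * d) - s * s * (y * (y * y) * b)
      ≡⟨ ring₂ x y s a b c d ⟩
    x * x * (x * a + y * c) - s * s * (y * y * (x * d + y * b))
      ≡⟨ cong (λ i → x * x * (x * a + y * c) - i * (y * y * (x * d + y * b))) s*s≡1 ⟩
    x * x * (x * a + y * c) - 1ℤ * (y * y * (x * d + y * b))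
      ≡⟨ cong (λ i → x * x * (x * a + y * c) - i) (ℤ.*-identityˡ _) ⟩
    x * x * (x * a + y * c) - y * y * (x * d + y * b)
      ≡⟨ cong (λ i → x * x * (x * a + y * c) - y * y * (x * d + y * G i)) (m-q+q m) ⟨
    x * x * H (m + q) - y * y * H (m - q) ∎
    where
    open ≡-Reasoning
    a = G (m + q)
    b = G m
    c = G (m + q + q)
    d = G (m - q)
    m+q-q : ∀ m q → m + q - q ≡ m
    m+q-q = solve-∀
    upper : l * a ≡ c + s * b
    upper = trans (G-multiplication (m + q)) (cong (λ i → c + s * G i) (m+q-q m q))
    ring₁ : ∀ x y l s a b → (x * (x * 1ℤ) + y * x * l + s * (y * (y * 1ℤ))) * (x * a - s * y * b) ≡
      x * x * (x * a) + x * x * y * (l * a) + s * x * (y * y) * a - s * (x * x) * y * b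
      - s * x * (y * y) * (l * b) - s * s * (y * (y * y) * b)
    ring₁ = solve-∀
    ring₂ : ∀ x y s a b c d →
      x * x * (x * a) + x * x * y * (c + s * b) + s * x * (y * y) * a - s * (x * x) * y * b
      - s * x * (y * y) * (a + s * d) - s * s * (y * (y * y) * b) ≡
      x * x * (x * a + y * c) - s * s * (y * y * (x * d + y * b))
    ring₂ = solve-∀

  open BinomialSums w

  -- With `k = suc j` this is f^(2k-1) e^(k-1) `Ĝ (r * + k + t)`, the powers of `f` and `e` being
  -- collected in `E ^ j`.
  Z : ℤ → ℕ → ℤ
  Z t j = E ^ j * (f * Ĝ (r * + suc j + t))

  R : ℕ → ℤ → ℤ
  R n t = x ^ (2 ℕ.* n) * H (p + t + q * + n) - y ^ (2 ℕ.* n) * H (p + t - q * + n)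

  -- Trades the shift of `j` for a shift of `t`; this is why `closed-form` is proved for all `t`
  -- simultaneously.
  Z-suc : ∀ t j → Z t (suc j) ≡ E * Z (t + r) j
  Z-suc t j = trans (ℤ.*-assoc E (E ^ j) _)
    (cong (λ i → E * (E ^ j * (f * Ĝ i))) (index r (+ suc j) t))
    where
    index : ∀ r k t → r * (1ℤ + k) + t ≡ r * k + (t + r)
    index = solve-∀

  power-suc : ∀ z n → z ^ (2 ℕ.* suc n) ≡ z * z * z ^ (2 ℕ.* n)
  power-suc z n = trans (cong (z *_) (cong (z ^_) (ℕ.+-suc n (n ℕ.+ 0))))
    (sym (ℤ.*-assoc z z _))

  -- Since w² = x² y², the terms with powers of `x` combine to `X₁` times the left-hand side of
  -- `H-step` at `u`, and those with powers of `y` to `Y₁` times the one at `v`.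
  R-recurrence : ∀ n t → R (2 ℕ.+ n) t + w * w * R n t ≡ + 2 * w * R (suc n) t + E * R (suc n) (t + r)
  R-recurrence n t
    rewrite power-suc x (suc n) | power-suc y (suc n) | power-suc x n | power-suc y n = begin
    x * x * X₁ * H (p + t + q * (1ℤ + + suc n)) - y * y * Y₁ * H (p + t - q * (1ℤ + + suc n))
      + w * w * (X * H (p + t + q * + n) - Y * H (p + t - q * + n))
      ≡⟨ cong₂ (λ i j → x * x * X₁ * H i - y * y * Y₁ * H j + w * w * (X * H (p + t + q * + n) - Y * H (p + t - q * + n)))
           (index₁ (p + t) q (+ suc n)) (index₂ (p + t) q (+ suc n)) ⟩
    x * x * X₁ * H (u + q) - y * y * Y₁ * H (v - q)
      + w * w * (X * H (p + t + q * + n) - Y * H (p + t - q * + n))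
      ≡⟨ cong₂ (λ i j → x * x * X₁ * H (u + q) - y * y * Y₁ * H (v - q) + w * w * (X * H i - Y * H j))
           (index₃ (p + t) q (+ n)) (index₄ (p + t) q (+ n)) ⟩
    x * x * X₁ * H (u + q) - y * y * Y₁ * H (v - q) + w * w * (X * H (u - q) - Y * H (v + q))
      ≡⟨ ring₁ x y s X Y (H (u + q)) (H (v - q)) (H (u - q)) (H (v + q)) ⟩
    x * x * X₁ * H (u + q) - y * y * Y₁ * H (v - q)
      + s * s * (y * y * X₁ * H (u - q) - x * x * Y₁ * H (v + q))
      ≡⟨ cong (λ i → x * x * X₁ * H (u + q) - y * y * Y₁ * H (v - q)
           + i * (y * y * X₁ * H (u - q) - x * x * Y₁ * H (v + q))) s*s≡1 ⟩
    x * x * X₁ * H (u + q) - y * y * Y₁ * H (v - q)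
      + 1ℤ * (y * y * X₁ * H (u - q) - x * x * Y₁ * H (v + q))
      ≡⟨ ring₂ (x * x) (y * y) X₁ Y₁ (H (u + q)) (H (v - q)) (H (u - q)) (H (v + q)) ⟩
    X₁ * (x * x * H (u + q) + y * y * H (u - q)) - Y₁ * (x * x * H (v + q) + y * y * H (v - q))
      ≡⟨ cong₂ (λ i j → X₁ * i - Y₁ * j) (H-step u) (H-step v) ⟩
    X₁ * (+ 2 * w * H u + E * H (u + r)) - Y₁ * (+ 2 * w * H v + E * H (v + r))
      ≡⟨ ring₃ X₁ Y₁ w E (H u) (H (u + r)) (H v) (H (v + r)) ⟩
    + 2 * w * (X₁ * H u - Y₁ * H v) + E * (X₁ * H (u + r) - Y₁ * H (v + r))
      ≡⟨ cong₂ (λ i j → + 2 * w * (X₁ * H u - Y₁ * H v) + E * (X₁ * H i - Y₁ * H j))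
           (index₅ p t r (q * + suc n)) (index₅ p t r (- (q * + suc n))) ⟩
    + 2 * w * (X₁ * H u - Y₁ * H v)
      + E * (X₁ * H (p + (t + r) + q * + suc n) - Y₁ * H (p + (t + r) - q * + suc n)) ∎
    where
    open ≡-Reasoning
    X = x ^ (2 ℕ.* n)
    Y = y ^ (2 ℕ.* n)
    X₁ = x * x * X
    Y₁ = y * y * Y
    u = p + t + q * + suc n
    v = p + t - q * + suc n
    index₁ : ∀ a q k → a + q * (1ℤ + k) ≡ a + q * k + q
    index₁ = solve-∀
    index₂ : ∀ a q k → a - q * (1ℤ + k) ≡ a - q * k - q
    index₂ = solve-∀
    index₃ : ∀ a q k → a + q * k ≡ a + q * (1ℤ + k) - q
    index₃ = solve-∀
    index₄ : ∀ a q k → a - q * k ≡ a - q * (1ℤ + k) + q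
    index₄ = solve-∀
    index₅ : ∀ p t r k → p + t + k + r ≡ p + (t + r) + k
    index₅ = solve-∀
    ring₁ : ∀ x y s X Y a b c d →
      x * x * (x * x * X) * a - y * y * (y * y * Y) * b + s * y * x * (s * y * x) * (X * c - Y * d) ≡
      x * x * (x * x * X) * a - y * y * (y * y * Y) * b
        + s * s * (y * y * (x * x * X) * c - x * x * (y * y * Y) * d)
    ring₁ = solve-∀
    ring₂ : ∀ x y X Y a b c d → x * X * a - y * Y * b + 1ℤ * (y * X * c - x * Y * d) ≡
      X * (x * a + y * c) - Y * (x * d + y * b)
    ring₂ = solve-∀
    ring₃ : ∀ X Y w E a b c d → X * (+ 2 * w * a + E * b) - Y * (+ 2 * w * c + E * d) ≡
      + 2 * w * (X * a - Y * c) + E * (X * b - Y * d)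
    ring₃ = solve-∀

  -- Both sides obey the same second-order recurrence in `n`; for `n = 0` both vanish, and `n = 1`
  -- is `H-base`.
  closed-form : ∀ n t → D * oddSum n (Z t) ≡ R n t
  closed-form zero t = trans (ℤ.*-zeroʳ D) (trans (ring₀ (H (p + t)))
    (cong₂ (λ i j → 1ℤ * H i - 1ℤ * H j) (index₁ (p + t) q) (index₂ (p + t) q)))
    where
    index₁ : ∀ a q → a ≡ a + q * 0ℤ
    index₁ = solve-∀
    index₂ : ∀ a q → a ≡ a - q * 0ℤ
    index₂ = solve-∀
    ring₀ : ∀ a → 0ℤ ≡ 1ℤ * a - 1ℤ * a
    ring₀ = solve-∀
  closed-form 1 t = begin
    D * (0ℤ + 1ℤ * 1ℤ * (1ℤ * (f * Ĝ (r * 1ℤ + t))))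
      ≡⟨ ring₁ D (f * Ĝ (r * 1ℤ + t)) ⟩
    D * (f * Ĝ (r * 1ℤ + t))
      ≡⟨ cong (λ i → D * (f * Ĝ i)) (index₁ p q t) ⟩
    D * (f * Ĝ (p + t + (p + q)))
      ≡⟨ H-base (p + t) ⟩
    x * x * H (p + t + q) - y * y * H (p + t - q)
      ≡⟨ ring₂ x y (H (p + t + q)) (H (p + t - q)) ⟩
    x * (x * 1ℤ) * H (p + t + q) - y * (y * 1ℤ) * H (p + t - q)
      ≡⟨ cong (λ i → x ^ 2 * H (p + t + i) - y ^ 2 * H (p + t - i)) (ℤ.*-identityʳ q) ⟨
    R 1 t ∎
    where
    open ≡-Reasoning
    index₁ : ∀ p q t → (+ 2 * p + q) * 1ℤ + t ≡ p + t + (p + q)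
    index₁ = solve-∀
    ring₁ : ∀ d a → d * (0ℤ + 1ℤ * 1ℤ * (1ℤ * a)) ≡ d * a
    ring₁ = solve-∀
    ring₂ : ∀ x y a b → x * x * a - y * y * b ≡ x * (x * 1ℤ) * a - y * (y * 1ℤ) * b
    ring₂ = solve-∀
  closed-form (suc (suc n)) t = +-cancelʳ (w * w * R n t) _ _ (begin
    D * oddSum (2 ℕ.+ n) (Z t) + w * w * R n t
      ≡⟨ cong (λ i → D * oddSum (2 ℕ.+ n) (Z t) + w * w * i) (closed-form n t) ⟨
    D * oddSum (2 ℕ.+ n) (Z t) + w * w * (D * oddSum n (Z t))
      ≡⟨ ring₁ D (oddSum (2 ℕ.+ n) (Z t)) w (oddSum n (Z t)) ⟩
    D * (oddSum (2 ℕ.+ n) (Z t) + w * w * oddSum n (Z t))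
      ≡⟨ cong (D *_) (oddSum-recurrence n (Z t)) ⟩
    D * (+ 2 * w * oddSum (suc n) (Z t) + oddSum (suc n) (Z t ∘ suc))
      ≡⟨ cong (λ i → D * (+ 2 * w * oddSum (suc n) (Z t) + i))
           (trans (oddSum-cong (suc n) (Z-suc t)) (oddSum-*ˡ (suc n) E (Z (t + r)))) ⟩
    D * (+ 2 * w * oddSum (suc n) (Z t) + E * oddSum (suc n) (Z (t + r)))
      ≡⟨ ring₂ D w (oddSum (suc n) (Z t)) E (oddSum (suc n) (Z (t + r))) ⟩
    + 2 * w * (D * oddSum (suc n) (Z t)) + E * (D * oddSum (suc n) (Z (t + r)))
      ≡⟨ cong₂ (λ i j → + 2 * w * i + E * j) (closed-form (suc n) t) (closed-form (suc n) (t + r)) ⟩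
    + 2 * w * R (suc n) t + E * R (suc n) (t + r)
      ≡⟨ R-recurrence n t ⟨
    R (2 ℕ.+ n) t + w * w * R n t ∎)
    where
    open ≡-Reasoning
    ring₁ : ∀ d a w b → d * a + w * w * (d * b) ≡ d * (a + w * w * b)
    ring₁ = solve-∀
    ring₂ : ∀ d w a e b → d * (+ 2 * w * a + e * b) ≡ + 2 * w * (d * a) + e * (d * b)
    ring₂ = solve-∀

-- The denominator

5-prime : Prime 5
5-prime = from-yes (prime? 5)

-- Infinite descent: 5 divides `m`, and writing m = 5k gives n² = 5k² with a smaller `k`.
√5-irrational : ∀ n m → m ℕ.* m ≡ 5 ℕ.* (n ℕ.* n) → n ≡ 0
√5-irrational = <-rec _ descend
  where
  open ≡-Reasoning
  descend : ∀ n → (∀ {k} → k ℕ.< n → ∀ m → m ℕ.* m ≡ 5 ℕ.* (k ℕ.* k) → k ≡ 0) →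
            ∀ m → m ℕ.* m ≡ 5 ℕ.* (n ℕ.* n) → n ≡ 0
  descend zero      rec m eq = refl
  descend n@(suc _) rec m eq with reduce
    (euclidsLemma m m 5-prime (divides (n ℕ.* n) (trans eq (ℕ.*-comm 5 (n ℕ.* n)))))
  -- The induction hypothesis gives k = 0, so n² = 0, although `n` is a successor.
  ... | divides k refl = contradiction (cong (λ i → 5 ℕ.* (i ℕ.* i)) (rec k<n n n²≡5k²))
                           (λ h → ℕ.1+n≢0 (trans n²≡5k² h))
    where
    reorder : ∀ k → k ℕ.* 5 ℕ.* (k ℕ.* 5) ≡ 5 ℕ.* (5 ℕ.* (k ℕ.* k))
    reorder = ℕ-Solver.solve-∀
    n²≡5k² : n ℕ.* n ≡ 5 ℕ.* (k ℕ.* k)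
    n²≡5k² = ℕ.*-cancelˡ-≡ _ _ 5 (trans (sym eq) (reorder k))
    k<n : k ℕ.< n
    -- If n ≤ k, then 5n² ≤ 5k² = n², which is impossible for positive `n`.
    k<n = ℕ.≰⇒> λ n≤k → ℕ.<⇒≱ (ℕ.m<m+n (n ℕ.* n) ℕ.z<s)
      (ℕ.≤-trans (ℕ.*-monoʳ-≤ 5 (ℕ.*-mono-≤ n≤k n≤k)) (ℕ.≤-reflexive (sym n²≡5k²)))

u²≡5v²⇒v≡0 : ∀ u v → u * u ≡ + 5 * (v * v) → v ≡ 0ℤ
u²≡5v²⇒v≡0 u v eq = ℤ.∣i∣≡0⇒i≡0 (√5-irrational ∣ v ∣ ∣ u ∣ (begin
  ∣ u ∣ ℕ.* ∣ u ∣          ≡⟨ ℤ.abs-* u u ⟨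
  ∣ u * u ∣                ≡⟨ cong ∣_∣ eq ⟩
  ∣ + 5 * (v * v) ∣        ≡⟨ ℤ.abs-* (+ 5) (v * v) ⟩
  5 ℕ.* ∣ v * v ∣          ≡⟨ cong (5 ℕ.*_) (ℤ.abs-* v v) ⟩
  5 ℕ.* (∣ v ∣ ℕ.* ∣ v ∣)  ∎))
  where open ≡-Reasoning

i*i≡0⇒i≡0 : ∀ i → i * i ≡ 0ℤ → i ≡ 0ℤ
i*i≡0⇒i≡0 i eq = reduce (ℤ.i*j≡0⇒i≡0∨j≡0 i eq)

[-1]^-≢0 : ∀ m → [-1]^ m ≢ 0ℤ
[-1]^-≢0 m eq = contradiction (trans (sym ([-1]^-square m)) (cong (λ i → i * i) eq)) λ ()

fib-suc-≢0 : ∀ n → fib (suc n) ≢ 0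
fib-suc-≢0 zero    ()
fib-suc-≢0 (suc n) eq = fib-suc-≢0 n (ℕ.m+n≡0⇒m≡0 (fib (suc n)) eq)

luc-≢0 : ∀ n → luc n ≢ 0
luc-≢0 zero          ()
luc-≢0 (suc zero)    ()
luc-≢0 (suc (suc n)) eq = luc-≢0 (suc n) (ℕ.m+n≡0⇒m≡0 (luc (suc n)) eq)

F≡0⇒≡0 : ∀ m → F m ≡ 0ℤ → m ≡ 0ℤ
F≡0⇒≡0 (+ zero)  eq = refl
F≡0⇒≡0 (+ suc n) eq = contradiction (ℤ.+-injective eq) (fib-suc-≢0 n)
F≡0⇒≡0 -[1+ n ]  eq with ℤ.i*j≡0⇒i≡0∨j≡0 ([-1]^ (+ n)) eq
... | inj₁ h = contradiction h ([-1]^-≢0 (+ n))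
... | inj₂ h = contradiction (ℤ.+-injective h) (fib-suc-≢0 n)

L≢0 : ∀ m → L m ≢ 0ℤ
L≢0 (+ n)    eq = luc-≢0 n (ℤ.+-injective eq)
L≢0 -[1+ n ] eq with ℤ.i*j≡0⇒i≡0∨j≡0 ([-1]^ (+ suc n)) eq
... | inj₁ h = [-1]^-≢0 (+ suc n) h
... | inj₂ h = luc-≢0 (suc n) (ℤ.+-injective h)

-- The case p = m = 0 of `L-addition` for `L` itself, as `L 0ℤ` is 2.
L²-4[-1]^≡5F² : ∀ q → L q * L q - + 4 * [-1]^ q ≡ + 5 * (F q * F q)
L²-4[-1]^≡5F² q = begin
  L q * L q - + 4 * [-1]^ q
    ≡⟨ cong (λ i → L q * L q - i) (ring₁ ([-1]^ q)) ⟩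
  L q * L q - [-1]^ q * + 2 * + 2
    ≡⟨ cong (λ i → L i * L i - [-1]^ q * + 2 * + 2) (ℤ.+-identityˡ q) ⟨
  L (0ℤ + q) * L (0ℤ + q) - [-1]^ q * L 0ℤ * L 0ℤ
    ≡⟨ L-addition L-fib 0ℤ q 0ℤ ⟩
  F q * (+ 2 * L (1ℤ + (0ℤ + (0ℤ + q))) - L (0ℤ + (0ℤ + q)))
    ≡⟨ cong (F q *_) (5F-via-L (0ℤ + (0ℤ + q))) ⟨
  F q * (+ 5 * F (0ℤ + (0ℤ + q)))
    ≡⟨ cong (λ i → F q * (+ 5 * F i)) (index q) ⟩
  F q * (+ 5 * F q)
    ≡⟨ ring₂ (F q) ⟩
  + 5 * (F q * F q) ∎
  where
  open ≡-Reasoning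
  index : ∀ q → 0ℤ + (0ℤ + q) ≡ q
  index = solve-∀
  ring₁ : ∀ s → + 4 * s ≡ s * + 2 * + 2
  ring₁ = solve-∀
  ring₂ : ∀ f → f * (+ 5 * f) ≡ + 5 * (f * f)
  ring₂ = solve-∀

denominator : ℤ → ℤ → ℤ → ℤ
denominator x y q = x ^ 2 + y * x * L q + [-1]^ q * y ^ 2

-- Completing the square leaves the discriminant (L q)² - 4 (-1)^q, which is 5 (F q)².
denominator≡0⇒F*y≡0 : ∀ x y q → denominator x y q ≡ 0ℤ → F q * y ≡ 0ℤ
denominator≡0⇒F*y≡0 x y q eq = u²≡5v²⇒v≡0 (+ 2 * x + y * L q) (F q * y) (begin
  (+ 2 * x + y * L q) * (+ 2 * x + y * L q)
    ≡⟨ ring₁ x y (L q) ([-1]^ q) ⟩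
  + 4 * denominator x y q + y * y * (L q * L q - + 4 * [-1]^ q)
    ≡⟨ cong₂ (λ i j → + 4 * i + y * y * j) eq (L²-4[-1]^≡5F² q) ⟩
  + 4 * 0ℤ + y * y * (+ 5 * (F q * F q))
    ≡⟨ ring₂ y (F q) ⟩
  + 5 * (F q * y * (F q * y)) ∎)
  where
  open ≡-Reasoning
  ring₁ : ∀ x y l s → (+ 2 * x + y * l) * (+ 2 * x + y * l) ≡
    + 4 * (x * (x * 1ℤ) + y * x * l + s * (y * (y * 1ℤ))) + y * y * (l * l - + 4 * s)
  ring₁ = solve-∀
  ring₂ : ∀ y f → + 4 * 0ℤ + y * y * (+ 5 * (f * f)) ≡ + 5 * (f * y * (f * y))
  ring₂ = solve-∀

-- One of `F q` and `U p` is zero. If `F q` is, then q = 0 and the denominator is 4 (U p)²; if `U p`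
-- is, the denominator is the square of `U (p + q)`.
denominator≡0 : ∀ (U : ℤ → ℤ) p q → denominator (U (p + q)) (U p) q ≡ 0ℤ →
                U p ≡ 0ℤ × (q ≡ 0ℤ ⊎ U (p + q) ≡ 0ℤ)
denominator≡0 U p q eq with ℤ.i*j≡0⇒i≡0∨j≡0 (F q) (denominator≡0⇒F*y≡0 (U (p + q)) (U p) q eq)
... | inj₁ Fq≡0 with refl ← F≡0⇒≡0 q Fq≡0 =
  i*i≡0⇒i≡0 (U p) (ℤ.*-cancelˡ-≡ (+ 4) _ _
    (trans (ring (U p)) (trans (cong (λ i → denominator (U i) (U p) 0ℤ) (sym (ℤ.+-identityʳ p))) eq)))
  , inj₁ refl
  where
  ring : ∀ y → + 4 * (y * y) ≡ y * (y * 1ℤ) + y * y * + 2 + 1ℤ * (y * (y * 1ℤ))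
  ring = solve-∀
... | inj₂ Up≡0 = Up≡0 , inj₂ (i*i≡0⇒i≡0 x (begin
  x * x                    ≡⟨ ring x (L q) ([-1]^ q) ⟩
  denominator x 0ℤ q       ≡⟨ cong (λ y → denominator x y q) Up≡0 ⟨
  denominator x (U p) q    ≡⟨ eq ⟩
  0ℤ                       ∎))
  where
  open ≡-Reasoning
  x = U (p + q)
  ring : ∀ x l s → x * x ≡ x * (x * 1ℤ) + 0ℤ * x * l + s * (0ℤ * (0ℤ * 1ℤ))
  ring = solve-∀

-- `F` vanishes only at 0, so a zero denominator forces p = 0 and then q = 0. In `L-denominator≢0`
-- no exception arises, since `L` has no zeros.
F-denominator≢0 : ∀ p q → ¬ (p ≡ 0ℤ × q ≡ 0ℤ) → denominator (F (p + q)) (F p) q ≢ 0ℤ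
F-denominator≢0 p q p,q≢0 eq with denominator≡0 F p q eq
... | Fp≡0 , rest with refl ← F≡0⇒≡0 p Fp≡0 =
  p,q≢0 (refl , [ id , (λ h → trans (sym (ℤ.+-identityˡ q)) (F≡0⇒≡0 (0ℤ + q) h)) ]′ rest)

L-denominator≢0 : ∀ p q → denominator (L (p + q)) (L p) q ≢ 0ℤ
L-denominator≢0 p q eq = L≢0 p (proj₁ (denominator≡0 L p q eq))

-- Passing to rationals

toℚᵘ-/ : ∀ i n → toℚᵘ (i / suc n) ≃ mkℚᵘ i n
toℚᵘ-/ i n = ℚ.toℚᵘ-fromℚᵘ (mkℚᵘ i n)

fromℤ-+ : ∀ i j → fromℤ (i + j) ≡ fromℤ i ℚ.+ fromℤ j
fromℤ-+ i j = ℚ.toℚᵘ-injective (begin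
  toℚᵘ (fromℤ (i + j))                  ≈⟨ toℚᵘ-/ (i + j) 0 ⟩
  mkℚᵘ (i + j) 0                        ≈⟨ *≡* (ring i j) ⟩
  mkℚᵘ i 0 ℚᵘ.+ mkℚᵘ j 0                ≈⟨ ℚᵘ.+-cong (toℚᵘ-/ i 0) (toℚᵘ-/ j 0) ⟨
  toℚᵘ (fromℤ i) ℚᵘ.+ toℚᵘ (fromℤ j)    ≈⟨ ℚ.toℚᵘ-homo-+ (fromℤ i) (fromℤ j) ⟨
  toℚᵘ (fromℤ i ℚ.+ fromℤ j)            ∎)
  where
  open ℚᵘ.≃-Reasoning
  ring : ∀ i j → (i + j) * 1ℤ ≡ (i * 1ℤ + j * 1ℤ) * 1ℤ
  ring = solve-∀

fromℤ-* : ∀ i j → fromℤ (i * j) ≡ fromℤ i ℚ.* fromℤ j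
fromℤ-* i j = ℚ.toℚᵘ-injective (begin
  toℚᵘ (fromℤ (i * j))                  ≈⟨ toℚᵘ-/ (i * j) 0 ⟩
  mkℚᵘ (i * j) 0                        ≈⟨ *≡* refl ⟩
  mkℚᵘ i 0 ℚᵘ.* mkℚᵘ j 0                ≈⟨ ℚᵘ.*-cong (toℚᵘ-/ i 0) (toℚᵘ-/ j 0) ⟨
  toℚᵘ (fromℤ i) ℚᵘ.* toℚᵘ (fromℤ j)    ≈⟨ ℚ.toℚᵘ-homo-* (fromℤ i) (fromℤ j) ⟨
  toℚᵘ (fromℤ i ℚ.* fromℤ j)            ∎)
  where open ℚᵘ.≃-Reasoning

fromℤ-/-* : ∀ i m .{{_ : ℕ.NonZero m}} a b → i * a ≡ + m * b → (i / m) ℚ.* fromℤ a ≡ fromℤ b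
fromℤ-/-* i zero    {{()}} a b eq
fromℤ-/-* i (suc m) a b eq = ℚ.toℚᵘ-injective (begin
  toℚᵘ ((i / suc m) ℚ.* fromℤ a)            ≈⟨ ℚ.toℚᵘ-homo-* (i / suc m) (fromℤ a) ⟩
  toℚᵘ (i / suc m) ℚᵘ.* toℚᵘ (fromℤ a)      ≈⟨ ℚᵘ.*-cong (toℚᵘ-/ i m) (toℚᵘ-/ a 0) ⟩
  mkℚᵘ i m ℚᵘ.* mkℚᵘ a 0                    ≈⟨ *≡* (trans (cong (_* 1ℤ) eq) (ring (+ suc m) b)) ⟩
  mkℚᵘ b 0                                  ≈⟨ toℚᵘ-/ b 0 ⟨
  toℚᵘ (fromℤ b)                            ∎)
  where
  open ℚᵘ.≃-Reasoning
  ring : ∀ m b → m * b * 1ℤ ≡ b * (m * 1ℤ)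
  ring = solve-∀

-- The numerator of the reduced fraction, multiplied by the gcd that was divided out, gives back
-- `i`.
fromℤ-≢0 : ∀ i → i ≢ 0ℤ → fromℤ i ≢ 0ℚ
fromℤ-≢0 i i≢0 eq = i≢0 (trans (sym (ℚ.↥-/ i 1)) (cong (λ r → ℚ.↥ r * gcd i (+ 1)) eq))

equals-over : ∀ r a b → b ≢ 0ℤ → r ℚ.* fromℤ b ≡ fromℤ a → r equals a over b
equals-over r a b b≢0 eq = nz , (begin
  r                                            ≡⟨ ℚ.*-identityʳ r ⟨
  r ℚ.* 1ℚ                                     ≡⟨ cong (r ℚ.*_) (ℚ.*-inverseʳ (fromℤ b)) ⟨
  r ℚ.* (fromℤ b ℚ.* (ℚ.1/ fromℤ b))           ≡⟨ ℚ.*-assoc r (fromℤ b) (ℚ.1/ fromℤ b) ⟨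
  r ℚ.* fromℤ b ℚ.* (ℚ.1/ fromℤ b)             ≡⟨ cong (ℚ._* (ℚ.1/ fromℤ b)) eq ⟩
  fromℤ a ℚ.÷ fromℤ b                          ∎)
  where
  open ≡-Reasoning
  nz : ℚ.NonZero (fromℤ b)
  nz = ℚ.≢-nonZero (fromℤ-≢0 b b≢0)
  instance _ = nz

∑-fromℤ : ∀ n c (f : ℕ → ℚ) (g : ℕ → ℤ) → (∀ j → j ℕ.< n → f (suc j) ℚ.* fromℤ c ≡ fromℤ (g j)) →
          ∑[1… n ] f ℚ.* fromℤ c ≡ fromℤ (∑< n g)
∑-fromℤ zero    c f g eq = ℚ.*-zeroˡ (fromℤ c)
∑-fromℤ (suc n) c f g eq = begin
  (∑[1… n ] f ℚ.+ f (suc n)) ℚ.* fromℤ c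
    ≡⟨ ℚ.*-distribʳ-+ (fromℤ c) (∑[1… n ] f) (f (suc n)) ⟩
  ∑[1… n ] f ℚ.* fromℤ c ℚ.+ f (suc n) ℚ.* fromℤ c
    ≡⟨ cong₂ ℚ._+_ (∑-fromℤ n c f g (λ j j<n → eq j (ℕ.m<n⇒m<1+n j<n))) (eq n ℕ.≤-refl) ⟩
  fromℤ (∑< n g) ℚ.+ fromℤ (g n)
    ≡⟨ fromℤ-+ (∑< n g) (g n) ⟨
  fromℤ (∑< (suc n) g) ∎
  where open ≡-Reasoning

-- `g j` is twice the rational summand at `k = suc j`; this 2 is the one in the denominator
-- `+ 2 * d`.
weighted-sum : ∀ n (T g : ℕ → ℤ) d a .{{_ : ℕ.NonZero n}} →
  (∀ j → j ℕ.< n → + suc j * (T (suc j) * + 2) ≡ + (n ℕ.+ suc j) * g j) →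
  d ≢ 0ℤ → d * ∑< n g ≡ a →
  ∑[1… n ] (λ k → (_/_ (+ k) (n ℕ.+ k) {{+-nonZero n k}}) ℚ.* fromℤ (T k)) equals a over + 2 * d
weighted-sum n T g d a eq d≢0 closed = equals-over S a (+ 2 * d)
  (λ h → d≢0 ([ (λ ()) , id ]′ (ℤ.i*j≡0⇒i≡0∨j≡0 (+ 2) h)))
  (begin
    S ℚ.* fromℤ (+ 2 * d)                ≡⟨ cong (S ℚ.*_) (fromℤ-* (+ 2) d) ⟩
    S ℚ.* (fromℤ (+ 2) ℚ.* fromℤ d)      ≡⟨ ℚ.*-assoc S (fromℤ (+ 2)) (fromℤ d) ⟨
    S ℚ.* fromℤ (+ 2) ℚ.* fromℤ d        ≡⟨ cong (ℚ._* fromℤ d) (∑-fromℤ n (+ 2) term g term-eq) ⟩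
    fromℤ (∑< n g) ℚ.* fromℤ d           ≡⟨ fromℤ-* (∑< n g) d ⟨
    fromℤ (∑< n g * d)                   ≡⟨ cong fromℤ (trans (ℤ.*-comm (∑< n g) d) closed) ⟩
    fromℤ a                              ∎)
  where
  open ≡-Reasoning
  term : ℕ → ℚ
  term k = (_/_ (+ k) (n ℕ.+ k) {{+-nonZero n k}}) ℚ.* fromℤ (T k)
  S = ∑[1… n ] term
  term-eq : ∀ j → j ℕ.< n → term (suc j) ℚ.* fromℤ (+ 2) ≡ fromℤ (g j)
  term-eq j j<n = trans (ℚ.*-assoc weight (fromℤ (T (suc j))) (fromℤ (+ 2)))
    (trans (cong (weight ℚ.*_) (sym (fromℤ-* (T (suc j)) (+ 2))))
      (fromℤ-/-* (+ suc j) (n ℕ.+ suc j) {{+-nonZero n (suc j)}} (T (suc j) * + 2) (g j) (eq j j<n)))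
    where
    weight = _/_ (+ suc j) (n ℕ.+ suc j) {{+-nonZero n (suc j)}}

^-distribʳ-* : ∀ i j n → (i * j) ^ n ≡ i ^ n * j ^ n
^-distribʳ-* i j zero    = refl
^-distribʳ-* i j (suc n) = trans (cong (i * j *_) (^-distribʳ-* i j n)) (ring i j (i ^ n) (j ^ n))
  where
  ring : ∀ i j a b → i * j * (a * b) ≡ i * a * (j * b)
  ring = solve-∀

odd-power : ∀ f j → f ^ (2 ℕ.* suc j ∸ 1) ≡ f * (f * f) ^ j
odd-power f j = begin
  f ^ (j ℕ.+ suc (j ℕ.+ 0))   ≡⟨ cong (f ^_) (ℕ.+-suc j (j ℕ.+ 0)) ⟩
  f * f ^ (2 ℕ.* j)           ≡⟨ cong (f *_) (ℤ.^-*-assoc f 2 j) ⟨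
  f * (f * (f * 1ℤ)) ^ j      ≡⟨ cong (λ i → f * (f * i) ^ j) (ℤ.*-identityʳ f) ⟩
  f * (f * f) ^ j             ∎
  where open ≡-Reasoning

-- The common form of the four identities

module Identity
  (U G Ĝ : ℤ → ℤ) (e : ℤ) (p q : ℤ)
  (G-addition : ∀ m → U (p + q) * G (m + q) - [-1]^ q * U p * G m ≡ F q * Ĝ (m + (p + q)))
  (Ĝ-addition : ∀ m → U (p + q) * Ĝ (m + q) - [-1]^ q * U p * Ĝ m ≡ F q * (e * G (m + (p + q))))
  (G-multiplication : ∀ m → L q * G m ≡ G (m + q) + [-1]^ q * G (m - q))
  where

  open ClosedForm {G} {Ĝ} {p} {q} {[-1]^ q} {U (p + q)} {U p} {F q} {L q} {e}
    ([-1]^-square q) G-addition Ĝ-addition G-multiplication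
  open BinomialSums w

  coefficient : ℕ → ℕ → ℤ
  coefficient n k = [-1]^ (q * + (n ∸ k)) * + ((n ℕ.+ k) C (n ∸ k))
    * U p ^ (n ∸ k) * U (p + q) ^ (n ∸ k) * F q ^ (2 ℕ.* k ∸ 1)

  -- The powers of `s`, `y` and `x` merge into `w ^ m`, those of `e` and `F q` into `E ^ j` with one
  -- `F q` left over; `weight-binomial` handles the rest.
  term-weight : ∀ n t j → j ℕ.< n →
    + suc j * (coefficient n (suc j) * (e ^ j * Ĝ (r * + suc j + t)) * + 2) ≡
    + (n ℕ.+ suc j) * (odd n j * Z t j)
  term-weight n t j j<n = begin
    + suc j * ([-1]^ (q * + m) * + c * y ^ m * x ^ m * F q ^ (2 ℕ.* suc j ∸ 1) * (e ^ j * g) * + 2)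
      ≡⟨ cong₂ (λ a b → + suc j * (a * + c * y ^ m * x ^ m * b * (e ^ j * g) * + 2))
           ([-1]^-*+ q m) (odd-power (F q) j) ⟩
    + suc j * (s ^ m * + c * y ^ m * x ^ m * (F q * (F q * F q) ^ j) * (e ^ j * g) * + 2)
      ≡⟨ ring₁ (+ suc j) (s ^ m) (+ c) (y ^ m) (x ^ m) (F q) ((F q * F q) ^ j) (e ^ j) g ⟩
    + 2 * + suc j * + c * (s ^ m * y ^ m * x ^ m * (e ^ j * (F q * F q) ^ j * (F q * g)))
      ≡⟨ cong₂ _*_ binomial (cong₂ (λ a b → a * (b * (F q * g))) w^m (sym (^-distribʳ-* e (F q * F q) j))) ⟩
    + (n ℕ.+ suc j) * + c′ * (w ^ m * (E ^ j * (F q * g)))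
      ≡⟨ ring₂ (+ (n ℕ.+ suc j)) (+ c′) (w ^ m) (E ^ j * (F q * g)) ⟩
    + (n ℕ.+ suc j) * (odd n j * Z t j) ∎
    where
    open ≡-Reasoning
    m = n ∸ suc j
    c = (n ℕ.+ suc j) C m
    c′ = (n ℕ.+ j) C suc (2 ℕ.* j)
    s = [-1]^ q
    x = U (p + q)
    y = U p
    g = Ĝ (r * + suc j + t)
    binomial : + 2 * + suc j * + c ≡ + (n ℕ.+ suc j) * + c′
    binomial = begin
      + 2 * + suc j * + c              ≡⟨ cong (_* + c) (ℤ.pos-* 2 (suc j)) ⟨
      + (2 ℕ.* suc j) * + c            ≡⟨ ℤ.pos-* (2 ℕ.* suc j) c ⟨
      + (2 ℕ.* suc j ℕ.* c)            ≡⟨ cong +_ (weight-binomial n j j<n) ⟩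
      + ((n ℕ.+ suc j) ℕ.* c′)         ≡⟨ ℤ.pos-* (n ℕ.+ suc j) c′ ⟩
      + (n ℕ.+ suc j) * + c′           ∎
    w^m : s ^ m * y ^ m * x ^ m ≡ w ^ m
    w^m = sym (trans (^-distribʳ-* (s * y) x m) (cong (_* x ^ m) (^-distribʳ-* s y m)))
    ring₁ : ∀ k s c y x f F e g → k * (s * c * y * x * (f * F) * (e * g) * + 2) ≡
            + 2 * k * c * (s * y * x * (e * F * (f * g)))
    ring₁ = solve-∀
    ring₂ : ∀ n c w z → n * c * (w * z) ≡ n * (c * w * z)
    ring₂ = solve-∀

  numerator : ℕ → ℤ → ℤ
  numerator n t =
    U (p + q) ^ (2 ℕ.* n)
      * (U (p + q) * G (p + t + q * + n) + U p * G (q + p + t + q * + n))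
    - U p ^ (2 ℕ.* n)
      * (U (p + q) * G (p + t - q * + n) + U p * G (q + p + t - q * + n))

  R≡numerator : ∀ n t → R n t ≡ numerator n t
  R≡numerator n t = cong₂
    (λ i j → U (p + q) ^ (2 ℕ.* n) * (U (p + q) * G (p + t + q * + n) + U p * G i)
           - U p ^ (2 ℕ.* n) * (U (p + q) * G (p + t - q * + n) + U p * G j))
    (index p q t (q * + n)) (index p q t (- (q * + n)))
    where
    index : ∀ p q t k → p + t + k + q ≡ q + p + t + k
    index = solve-∀

  -- `T` is arbitrary up to an equation because the four summands carry the power of 5 differently:
  -- not at all, as `5 ^ k`, or as `5 ^ (k ∸ 1)`. The equation is at successors, as the sum starts
  -- at `k = 1`.
  identity : ∀ n .{{_ : ℕ.NonZero n}} t (T : ℕ → ℤ) →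
    (∀ j → T (suc j) ≡ coefficient n (suc j) * (e ^ j * Ĝ ((+ 2 * p + q) * + suc j + t))) →
    denominator (U (p + q)) (U p) q ≢ 0ℤ →
    ∑[1… n ] (λ k → (_/_ (+ k) (n ℕ.+ k) {{+-nonZero n k}}) ℚ.* fromℤ (T k))
      equals numerator n t over
      + 2 * (U (p + q) ^ 2 + U p * U (p + q) * L q + [-1]^ q * U p ^ 2)
  identity n t T T-eq d≢0 = weighted-sum n T (λ j → odd n j * Z t j) _ _
    (λ j j<n → trans (cong (λ i → + suc j * (i * + 2)) (T-eq j)) (term-weight n t j j<n))
    d≢0 (trans (closed-form n t) (R≡numerator n t))

theorem21 : ∀ (n : ℕ) .{{_ : ℕ.NonZero n}} (p q t : ℤ) →
    (¬ (p ≡ 0ℤ × q ≡ 0ℤ) →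
    (∑[1… n ] (λ k →
    (_/_ (+ k) (n ℕ.+ k) {{+-nonZero n k}}) ℚ.*
    fromℤ ([-1]^ (q * + (n ∸ k)) * + ((n ℕ.+ k) C (n ∸ k))
    * F p ^ (n ∸ k) * F (p + q) ^ (n ∸ k)
    * F q ^ (2 ℕ.* k ∸ 1) * L ((+ 2 * p + q) * + k + t)))
    equals
    F (p + q) ^ (2 ℕ.* n)
    * (F (p + q) * L (p + t + q * + n) + F p * L (q + p + t + q * + n))
    - F p ^ (2 ℕ.* n)
    * (F (p + q) * L (p + t - q * + n) + F p * L (q + p + t - q * + n))
    over
    + 2 * (F (p + q) ^ 2 + F p * F (p + q) * L q + [-1]^ q * F p ^ 2)))
    × (¬ (p ≡ 0ℤ × q ≡ 0ℤ) →
    (∑[1… n ] (λ k →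
    (_/_ (+ k) (n ℕ.+ k) {{+-nonZero n k}}) ℚ.*
    fromℤ ([-1]^ (q * + (n ∸ k)) * + ((n ℕ.+ k) C (n ∸ k))
    * F p ^ (n ∸ k) * F (p + q) ^ (n ∸ k)
    * F q ^ (2 ℕ.* k ∸ 1) * F ((+ 2 * p + q) * + k + t)))
    equals
    F (p + q) ^ (2 ℕ.* n)
    * (F (p + q) * F (p + t + q * + n) + F p * F (q + p + t + q * + n))
    - F p ^ (2 ℕ.* n)
    * (F (p + q) * F (p + t - q * + n) + F p * F (q + p + t - q * + n))
    over
    + 2 * (F (p + q) ^ 2 + F p * F (p + q) * L q + [-1]^ q * F p ^ 2)))
    × (∑[1… n ] (λ k →
    (_/_ (+ k) (n ℕ.+ k) {{+-nonZero n k}}) ℚ.*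
    fromℤ ([-1]^ (q * + (n ∸ k)) * + ((n ℕ.+ k) C (n ∸ k))
    * L p ^ (n ∸ k) * L (p + q) ^ (n ∸ k)
    * F q ^ (2 ℕ.* k ∸ 1) * (+ 5) ^ k * F ((+ 2 * p + q) * + k + t)))
    equals
    L (p + q) ^ (2 ℕ.* n)
    * (L (p + q) * L (p + t + q * + n) + L p * L (q + p + t + q * + n))
    - L p ^ (2 ℕ.* n)
    * (L (p + q) * L (p + t - q * + n) + L p * L (q + p + t - q * + n))
    over
    + 2 * (L (p + q) ^ 2 + L p * L (p + q) * L q + [-1]^ q * L p ^ 2))
    × (∑[1… n ] (λ k →
    (_/_ (+ k) (n ℕ.+ k) {{+-nonZero n k}}) ℚ.*
    fromℤ ([-1]^ (q * + (n ∸ k)) * + ((n ℕ.+ k) C (n ∸ k))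
    * L p ^ (n ∸ k) * L (p + q) ^ (n ∸ k)
    * F q ^ (2 ℕ.* k ∸ 1) * (+ 5) ^ (k ∸ 1) * L ((+ 2 * p + q) * + k + t)))
    equals
    L (p + q) ^ (2 ℕ.* n)
    * (L (p + q) * F (p + t + q * + n) + L p * F (q + p + t + q * + n))
    - L p ^ (2 ℕ.* n)
    * (L (p + q) * F (p + t - q * + n) + L p * F (q + p + t - q * + n))
    over
    + 2 * (L (p + q) ^ 2 + L p * L (p + q) * L q + [-1]^ q * L p ^ 2))
theorem21 n p q t =
    (λ p,q≢0 → identity₁ n t (λ k → coefficient₁ n k * L (index k))
       (λ j → unit (coefficient₁ n (suc j)) j (L (index (suc j)))) (F-denominator≢0 p q p,q≢0))
  , (λ p,q≢0 → identity₂ n t (λ k → coefficient₂ n k * F (index k))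
       (λ j → unit (coefficient₂ n (suc j)) j (F (index (suc j)))) (F-denominator≢0 p q p,q≢0))
  , identity₃ n t (λ k → coefficient₃ n k * (+ 5) ^ k * F (index k))
      (λ j → five (coefficient₃ n (suc j)) ((+ 5) ^ j) (F (index (suc j)))) (L-denominator≢0 p q)
  , identity₄ n t (λ k → coefficient₄ n k * (+ 5) ^ (k ∸ 1) * L (index k))
      (λ j → ℤ.*-assoc (coefficient₄ n (suc j)) ((+ 5) ^ j) (L (index (suc j)))) (L-denominator≢0 p q)
  where
  index : ℕ → ℤ
  index k = (+ 2 * p + q) * + k + t

  unit-addition : ∀ {G} → FibLike G → ∀ m →
    F (p + q) * G (m + q) - [-1]^ q * F p * G m ≡ F q * (1ℤ * G (m + (p + q)))
  unit-addition {G} G-fib m = trans (F-addition G-fib p q m)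
    (cong (F q *_) (sym (ℤ.*-identityˡ (G (m + (p + q))))))

  L-addition-L : ∀ m → L (p + q) * L (m + q) - [-1]^ q * L p * L m ≡ F q * (+ 5 * F (m + (p + q)))
  L-addition-L m = trans (L-addition L-fib p q m)
    (cong (F q *_) (sym (5F-via-L (m + (p + q)))))

  L-addition-F : ∀ m → L (p + q) * F (m + q) - [-1]^ q * L p * F m ≡ F q * L (m + (p + q))
  L-addition-F m = trans (L-addition F-fib p q m)
    (cong (F q *_) (sym (L-via-F (m + (p + q)))))

  L-addition-5F : ∀ m → L (p + q) * (+ 5 * F (m + q)) - [-1]^ q * L p * (+ 5 * F m) ≡
                  F q * (+ 5 * L (m + (p + q)))
  L-addition-5F m = trans (ring₁ (L (p + q)) (F (m + q)) ([-1]^ q * L p) (F m))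
    (trans (cong (+ 5 *_) (L-addition-F m)) (ring₂ (F q) (L (m + (p + q)))))
    where
    ring₁ : ∀ a b c d → a * (+ 5 * b) - c * (+ 5 * d) ≡ + 5 * (a * b - c * d)
    ring₁ = solve-∀
    ring₂ : ∀ a b → + 5 * (a * b) ≡ a * (+ 5 * b)
    ring₂ = solve-∀

  open Identity F L L 1ℤ p q (F-addition L-fib p q) (unit-addition L-fib) (L-multiplication L-fib q)
    using () renaming (identity to identity₁; coefficient to coefficient₁)
  open Identity F F F 1ℤ p q (F-addition F-fib p q) (unit-addition F-fib) (L-multiplication F-fib q)
    using () renaming (identity to identity₂; coefficient to coefficient₂)
  -- Taking `5F` as the companion of `L` supplies the extra 5 that makes `5 ^ k` out of `e ^ j` with
  -- `k = suc j`.
  open Identity L L (λ m → + 5 * F m) (+ 5) p q L-addition-L L-addition-5F (L-multiplication L-fib q)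
    using () renaming (identity to identity₃; coefficient to coefficient₃)
  open Identity L F L (+ 5) p q L-addition-F L-addition-L (L-multiplication F-fib q)
    using () renaming (identity to identity₄; coefficient to coefficient₄)

  unit : ∀ c j a → c * a ≡ c * (1ℤ ^ j * a)
  unit c j a = cong (c *_) (sym (trans (cong (_* a) (ℤ.^-zeroˡ j)) (ℤ.*-identityˡ a)))

  five : ∀ c v a → c * (+ 5 * v) * a ≡ c * (v * (+ 5 * a))
  five = solve-∀
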